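{- For each integer $k\ge 3$ and each (fixed) $\varepsilon'>0$, there is a $\left(\frac{k}{2}+\varepsilon'\right)$-approximation algorithm for min-max BCP$_k$ that runs in $O(|V|^3|E|/\varepsilon')$ time on an input $(G=(V,E),w)$.
   Context: Graphs are finite, simple and undirected. For $w\colon V\to\mathbb{Q}_{\ge0}$ and $V'\subseteq V$, $w(V')=\sum_{v\in V'}w(v)$. A connected $k$-partition of a connected graph $G=(V,E)$ is a partition of $V$ into $k$ nonempty classes each inducing a connected subgraph of $G$; for such $\mathcal{P}=\{V_1,\dots,V_k\}$, $w^+(\mathcal{P})=\max_i w(V_i)$. Problem min-max BCP$_k$ ($k$ fixed): given a connected graph $G=(V,E)$ (with $|V|\ge k$) and a weight function $w\colon V\to\mathbb{Q}_{\ge0}$, find a connected $k$-partition $\mathcal{P}$ of $G$ minimizing $w^+(\mathcal{P})$. An $\alpha$-approximation algorithm for this minimization problem is a polynomial-time algorithm that on every instance returns a feasible solution of value at most $\alpha$ times the optimal value. Running times count elementary operations, arithmetic operations having unit cost. -}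

module Defs where

open import Data.Bool.Base using (Bool; if_then_else_; not; _∧_; true; false)
open import Data.Fin.Base using (Fin; toℕ; fromℕ<; remQuot)
import Data.Fin.Properties as Fin
open import Data.Fin.Subset using (Subset; _∈_; ⊤)
open import Data.Fin.Subset.Properties using (_∈?_)
open import Data.Integer.Base using (+_)
open import Data.List.Base using (List; length; filter; allFin; cartesianProduct)
open import Data.Nat.Base as ℕ using (ℕ; zero; suc; _≤_)
import Data.Nat.Properties as ℕ
open import Data.Product.Base using (∃; ∃-syntax; _×_; _,_; uncurry)
open import Data.Rational.Base as ℚ using (ℚ; 0ℚ)
import Data.Rational.Properties as ℚ
open import Data.Vec.Base using (tabulate)
import Data.Vec.Functional as Vector
open import Level using (0ℓ)
open import Relation.Binary.Construct.Closure.ReflexiveTransitive using (Star)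
open import Relation.Binary.Core using (Rel)
open import Relation.Binary.Definitions using (Decidable; Symmetric; Irreflexive)
open import Relation.Binary.PropositionalEquality.Core using (_≡_)
open import Relation.Nullary.Decidable.Core using (does; yes; no; _×-dec_)
open import Algebra.Properties.CommutativeMonoid.Sum ℚ.+-0-commutativeMonoid using (sum)

fromℕ : ℕ → ℚ
fromℕ n = (+ n) ℚ./ 1

------------------------------------------------------------------------
-- Graphs and connected partitions

record Graph (n : ℕ) : Set₁ where
  field
    _~_     : Rel (Fin n) 0ℓ
    _~?_    : Decidable _~_
    ~-sym   : Symmetric _~_
    ~-irrefl : Irreflexive _≡_ _~_

  -- Each undirected edge is listed once, as (u , v) with u < v.
  edges : List (Fin n × Fin n)
  edges = filter (uncurry λ u v → (u Fin.<? v) ×-dec (u ~? v))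
                 (cartesianProduct (allFin n) (allFin n))

  ∣E∣ : ℕ
  ∣E∣ = length edges

  InducedEdge : Subset n → Rel (Fin n) 0ℓ
  InducedEdge S u v = u ∈ S × v ∈ S × u ~ v

  InducesConnected : Subset n → Set
  InducesConnected S = ∀ {u v} → u ∈ S → v ∈ S → Star (InducedEdge S) u v

  Connected : Set
  Connected = InducesConnected ⊤

weight : ∀ {n} → (Fin n → ℚ) → Subset n → ℚ
weight w S = sum λ v → if does (v ∈? S) then w v else 0ℚ

record ConnectedPartition (k : ℕ) {n : ℕ} (G : Graph n) : Set where
  field
    class : Fin n → Fin k

  part : Fin k → Subset n
  part i = tabulate λ v → does (class v Fin.≟ i)

  field
    nonempty  : ∀ i → ∃[ v ] v ∈ part i
    connected : ∀ i → Graph.InducesConnected G (part i)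

open ConnectedPartition public using (class; part)

-- Starting the maximum at 0ℚ is harmless: the weights of instances are
-- nonnegative.
w⁺ : ∀ {k n} {G : Graph n} → (Fin n → ℚ) → ConnectedPartition k G → ℚ
w⁺ w P = Vector.foldr ℚ._⊔_ 0ℚ λ i → weight w (part P i)

IsOptimal : ∀ {k n} {G : Graph n} → (Fin n → ℚ) → ConnectedPartition k G → Set
IsOptimal {k} {G = G} w P = (Q : ConnectedPartition k G) → w⁺ w P ℚ.≤ w⁺ w Q

record Instance (k : ℕ) : Set₁ where
  field
    ∣V∣         : ℕ
    graph       : Graph ∣V∣
    w           : Fin ∣V∣ → ℚ
    G-connected : Graph.Connected graph
    k≤∣V∣       : k ≤ ∣V∣
    w-nonneg    : ∀ v → 0ℚ ℚ.≤ w v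

  open Graph graph public using (∣E∣)

------------------------------------------------------------------------
-- Algorithms: a random access machine with unit-cost arithmetic,
-- presented as a structured imperative language.
--
-- The memory consists of infinite arrays of naturals and of rationals, of
-- which a program can name only finitely many; array cell 0 serves as a
-- scalar variable.  There is deliberately neither a floor operation nor
-- any other unit-cost passage from rationals to naturals, since at unit
-- cost these would allow computations that are not reasonably counted as
-- polynomial time.

data Sort : Set where
  nat rat : Sort

⟦_⟧ : Sort → Set
⟦ nat ⟧ = ℕ
⟦ rat ⟧ = ℚ

Store : Set
Store = (s : Sort) → (array index : ℕ) → ⟦ s ⟧

update : (s : Sort) → ℕ → ℕ → ⟦ s ⟧ → Store → Store
update nat a i x σ nat b j = if does (a ℕ.≟ b) ∧ does (i ℕ.≟ j) then x else σ nat b j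
update nat a i x σ rat b j = σ rat b j
update rat a i x σ nat b j = σ nat b j
update rat a i x σ rat b j = if does (a ℕ.≟ b) ∧ does (i ℕ.≟ j) then x else σ rat b j

infixl 6 _⊕_ _⊖_
infixl 7 _⊗_ _⊘_

data Exp : Sort → Set where
  lit         : ∀ {s} → ⟦ s ⟧ → Exp s
  read        : (s : Sort) (array : ℕ) → Exp nat → Exp s
  _⊕_ _⊖_ _⊗_ : ∀ {s} → Exp s → Exp s → Exp s
  _⊘_         : Exp rat → Exp rat → Exp rat
  cast        : Exp nat → Exp rat

data Cond : Set where
  _≤ᶜ_ : ∀ {s} → Exp s → Exp s → Cond
  notᶜ : Cond → Cond
  _∧ᶜ_ : Cond → Cond → Cond

infixr 5 _⨾_

data Program : Set where
  skip          : Program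
  write         : (s : Sort) (array : ℕ) → Exp nat → Exp s → Program
  _⨾_           : Program → Program → Program
  ifᵖ_then_else_ : Cond → Program → Program → Program
  while_loop_   : Cond → Program → Program

add sub mul : (s : Sort) → ⟦ s ⟧ → ⟦ s ⟧ → ⟦ s ⟧
add nat = ℕ._+_
add rat = ℚ._+_
sub nat = ℕ._∸_
sub rat = ℚ._-_
mul nat = ℕ._*_
mul rat = ℚ._*_

-- Total division, with p / 0 = 0.
div : ℚ → ℚ → ℚ
div p q with q ℚ.≟ 0ℚ
... | yes _   = 0ℚ
... | no  q≢0 = ℚ._÷_ p q {{ℚ.≢-nonZero q≢0}}

leq : (s : Sort) → ⟦ s ⟧ → ⟦ s ⟧ → Bool
leq nat x y = does (x ℕ.≤? y)
leq rat x y = does (x ℚ.≤? y)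

eval : ∀ {s} → Exp s → Store → ⟦ s ⟧
eval (lit x)      σ = x
eval (read s a e) σ = σ s a (eval e σ)
eval (_⊕_ {s} e f) σ = add s (eval e σ) (eval f σ)
eval (_⊖_ {s} e f) σ = sub s (eval e σ) (eval f σ)
eval (_⊗_ {s} e f) σ = mul s (eval e σ) (eval f σ)
eval (e ⊘ f)      σ = div (eval e σ) (eval f σ)
eval (cast e)     σ = fromℕ (eval e σ)

test : Cond → Store → Bool
test (_≤ᶜ_ {s} e f) σ = leq s (eval e σ) (eval f σ)
test (notᶜ c)       σ = not (test c σ)
test (c ∧ᶜ d)       σ = test c σ ∧ test d σ

cost : ∀ {s} → Exp s → ℕ
cost (lit x)      = 1
cost (read s a e) = 1 ℕ.+ cost e
cost (e ⊕ f)      = 1 ℕ.+ (cost e ℕ.+ cost f)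
cost (e ⊖ f)      = 1 ℕ.+ (cost e ℕ.+ cost f)
cost (e ⊗ f)      = 1 ℕ.+ (cost e ℕ.+ cost f)
cost (e ⊘ f)      = 1 ℕ.+ (cost e ℕ.+ cost f)
cost (cast e)     = 1 ℕ.+ cost e

costᶜ : Cond → ℕ
costᶜ (e ≤ᶜ f) = 1 ℕ.+ (cost e ℕ.+ cost f)
costᶜ (notᶜ c) = 1 ℕ.+ costᶜ c
costᶜ (c ∧ᶜ d) = 1 ℕ.+ (costᶜ c ℕ.+ costᶜ d)

-- ⟨ p , σ ⟩⇓⟨ τ , t ⟩: started in σ, p halts in τ after t elementary
-- operations.
infix 4 ⟨_,_⟩⇓⟨_,_⟩

data ⟨_,_⟩⇓⟨_,_⟩ : Program → Store → Store → ℕ → Set where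
  ⇓-skip : ∀ {σ} →
    ⟨ skip , σ ⟩⇓⟨ σ , 1 ⟩
  ⇓-write : ∀ {s a i e σ} →
    ⟨ write s a i e , σ ⟩⇓⟨ update s a (eval i σ) (eval e σ) σ
                          , 1 ℕ.+ (cost i ℕ.+ cost e) ⟩
  ⇓-seq : ∀ {p q σ τ υ t u} →
    ⟨ p , σ ⟩⇓⟨ τ , t ⟩ → ⟨ q , τ ⟩⇓⟨ υ , u ⟩ →
    ⟨ p ⨾ q , σ ⟩⇓⟨ υ , t ℕ.+ u ⟩
  ⇓-then : ∀ {c p q σ τ t} →
    test c σ ≡ true → ⟨ p , σ ⟩⇓⟨ τ , t ⟩ →
    ⟨ ifᵖ c then p else q , σ ⟩⇓⟨ τ , 1 ℕ.+ (costᶜ c ℕ.+ t) ⟩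
  ⇓-else : ∀ {c p q σ τ t} →
    test c σ ≡ false → ⟨ q , σ ⟩⇓⟨ τ , t ⟩ →
    ⟨ ifᵖ c then p else q , σ ⟩⇓⟨ τ , 1 ℕ.+ (costᶜ c ℕ.+ t) ⟩
  ⇓-done : ∀ {c p σ} →
    test c σ ≡ false →
    ⟨ while c loop p , σ ⟩⇓⟨ σ , 1 ℕ.+ costᶜ c ⟩
  ⇓-loop : ∀ {c p σ τ υ t u} →
    test c σ ≡ true →
    ⟨ p , σ ⟩⇓⟨ τ , t ⟩ → ⟨ while c loop p , τ ⟩⇓⟨ υ , u ⟩ →
    ⟨ while c loop p , σ ⟩⇓⟨ υ , 1 ℕ.+ (costᶜ c ℕ.+ (t ℕ.+ u)) ⟩

------------------------------------------------------------------------
-- Input, output and approximation algorithms for min-max BCP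

module _ {k : ℕ} (I : Instance k) where
  open Instance I
  open Graph graph using (_~?_)

  -- Row-major adjacency matrix; the entry of (u , v) is at position
  -- toℕ u * ∣V∣ + toℕ v.
  adjacency : ℕ → ℕ
  adjacency p with p ℕ.<? ∣V∣ ℕ.* ∣V∣
  ... | yes p<n² = uncurry (λ u v → if does (u ~? v) then 1 else 0)
                           (remQuot ∣V∣ (fromℕ< p<n²))
  ... | no  _    = 0

  weights : ℕ → ℚ
  weights p with p ℕ.<? ∣V∣
  ... | yes p<n = w (fromℕ< p<n)
  ... | no  _   = 0ℚ

  load : Store
  load nat 0 0 = ∣V∣
  load nat 1 p = adjacency p
  load rat 0 p = weights p
  load nat _ _ = 0
  load rat _ _ = 0ℚ

  -- The class of each vertex is read off from array 2.
  Represents : Store → ConnectedPartition k graph → Set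
  Represents σ P = ∀ v → σ nat 2 (toℕ v) ≡ toℕ (class P v)

  Outputs : Program → ConnectedPartition k graph → Set
  Outputs A P = ∃[ σ ] ∃[ t ] ⟨ A , load ⟩⇓⟨ σ , t ⟩ × Represents σ P

  -- Evaluation is deterministic, so there is at most one such t.
  HaltsAfter : Program → ℕ → Set
  HaltsAfter A t = ∃[ σ ] ⟨ A , load ⟩⇓⟨ σ , t ⟩

PolynomialTime : ℕ → Program → Set₁
PolynomialTime k A = ∃[ c ] ∃[ d ] ((I : Instance k) → let open Instance I in
  ∃[ t ] HaltsAfter I A t × t ≤ c ℕ.* (∣V∣ ℕ.+ ∣E∣) ℕ.^ d)

record IsApproximationAlgorithm (k : ℕ) (α : ℚ) (A : Program) : Set₁ where
  field
    polynomialTime : PolynomialTime k A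
    approximates   : (I : Instance k) → let open Instance I in
      ∃[ P ] Outputs I A P ×
             ((P* : ConnectedPartition k graph) → IsOptimal w P* → w⁺ w P ℚ.≤ α ℚ.* w⁺ w P*)

{-# OPTIONS --safe #-}

-- Let W be the total weight.  Some vertex c, the hub, is such that V - c
-- splits into connected classes that are adjacent to c and weigh at most W/2:
-- as long as a component of G - c on the current side is heavier, move c to a
-- neighbour inside it.  From singletons, merge within these classes, then merge
-- adjacent classes off c as long as the union weighs at most W/2, then absorb
-- the lightest class into that of c, always stopping at exactly k classes.
-- If the class of c ends up heavier than W/2, then the k - 1 ≥ 2 other classes,
-- which are the heaviest ones, weigh less than W/2 together.  So no two classes
-- were adjacent before the absorptions, i.e. they were the components of G - c.
-- The classes off c of any connected k-partition meet at most k - 1 of these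
-- components, so its class of c is at least as heavy as ours.  All other classes
-- weigh at most W/2 ≤ (k/2) OPT.  The running time is O(n⁴), and n ≤ 2m.
module Submission where

open import Defs
open import Algebra.Bundles using (CommutativeMonoid)
import Algebra.Properties.CommutativeMonoid.Sum as Sum
open import Data.Bool.Base using (Bool; true; false; if_then_else_; not; _∧_; _∨_)
import Data.Bool.Properties as Bool
open import Data.Fin.Base as Fin using (Fin; zero; suc; toℕ; fromℕ<)
import Data.Fin.Properties as Fin
import Data.Fin.Subset as Subset
import Data.Fin.Subset.Properties as Subset
open import Data.Integer.Base as ℤ using (+_)
import Data.Integer.Properties as ℤ
open import Data.List.Base using (List; _++_; map; lookup)
import Data.List.Membership.Propositional as List
open import Data.List.Membership.Propositional.Properties using (∈-filter⁺; ∈-cartesianProduct⁺; ∈-allFin; ∈-map⁺; ∈-++⁺ˡ; ∈-++⁺ʳ)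
open import Data.List.Properties using (length-map; length-++)
open import Data.List.Relation.Unary.Any using (index)
open import Data.List.Relation.Unary.Any.Properties using (lookup-index)
open import Data.Nat.Base as ℕ using (ℕ; zero; suc; z≤n; s≤s; NonZero)
import Data.Nat.Properties as ℕ
import Data.Nat.Solver
open import Data.Product.Base using (∃-syntax; _×_; _,_; proj₁; proj₂; uncurry)
open import Data.Rational.Base as ℚ using (ℚ; 0ℚ; Positive; _+_; _÷_; _/_; _≤_)
import Data.Rational.Properties as ℚ
open import Data.Rational.Properties using (pos⇒nonZero)
open import Data.Rational.Solver using (module +-*-Solver)
import Data.Rational.Unnormalised.Base as ℚᵘ
import Data.Rational.Unnormalised.Properties as ℚᵘ
open import Data.Sum.Base using (_⊎_; inj₁; inj₂)
open import Data.Unit.Base using (⊤)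
open import Data.Vec.Base using (tabulate)
import Data.Vec.Functional as Vector
open import Data.Vec.Properties using ([]=⇒lookup; lookup⇒[]=; lookup∘tabulate)
open import Function.Base using (_∘_; id)
open import Level using (0ℓ)
open import Relation.Binary.Construct.Closure.ReflexiveTransitive as Star using (Star; ε; _◅_; _◅◅_)
open import Relation.Binary.Core using (Rel)
open import Relation.Binary.Definitions using (Symmetric; tri<; tri≈; tri>)
open import Relation.Binary.PropositionalEquality
open import Relation.Nullary using (¬_; Dec; does; yes; no; ¬?; _×-dec_; contradiction)
open import Relation.Nullary.Decidable using (dec-true; dec-false)

-- Total correctness of programs with time bounds

-- The hub's class is the obstacle. It takes in whatever is left over, so no cap restrains it, and
-- when it is heavy it has to be compared with the hub's class in an arbitrary competitor. For that
-- comparison the classes left outside must outweigh any choice of equally many original classes,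
-- which `greedy` records for sets of labels and an exchange argument maintains. The quota `k`
-- interferes with all structural claims: a merging phase stopped by it may leave classes that do
-- not touch the hub. But then exactly `k` classes remain, nothing is absorbed, and the hub stays a
-- class by itself; the case distinctions between `count L ≤ k` and adjacency to the hub come from
-- here. Weights are doubled rather than halved throughout. One program, `scan`, does all merging
-- off the hub, and only the quota, the limit and the sides vary. The exponent 4 arises in the hub
-- search: at most `n` rounds, each scanning all ordered pairs, where a merge relabels up to `n`
-- vertices. One of the factors `n` is then traded for `2m`, and the constant is scaled by an
-- integer above `ε̄` to allow the division by `ε′`.

size : Program → ℕ
size skip                    = 1
size (write s a i e)         = 1 ℕ.+ (cost i ℕ.+ cost e)
size (p ⨾ q)                 = size p ℕ.+ size q
size (ifᵖ c then p else q)   = suc (costᶜ c) ℕ.+ (size p ℕ.+ size q)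
-- The guard is evaluated once more than the body, hence at most n + 1 ≤ 2n times for positive n;
-- this is why its cost enters twice.
size (while c loop p)        = (suc (costᶜ c) ℕ.+ suc (costᶜ c)) ℕ.+ size p

depth : Program → ℕ
depth skip                  = 0
depth (write s a i e)       = 0
depth (p ⨾ q)               = depth p ℕ.⊔ depth q
depth (ifᵖ c then p else q) = depth p ℕ.⊔ depth q
depth (while c loop p)      = suc (depth p)

_==_ : Sort → Sort → Bool
nat == nat = true
rat == rat = true
_   == _   = false

-- Boolean-valued, so that for concrete programs `writes p s a ≡ false` holds by computation and
-- frame conditions are discharged by `refl`.
writes : Program → Sort → ℕ → Bool
writes skip                  s a = false
writes (write s′ a′ i e)     s a = (s′ == s) ∧ does (a′ ℕ.≟ a)
writes (p ⨾ q)               s a = writes p s a ∨ writes q s a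
writes (ifᵖ c then p else q) s a = writes p s a ∨ writes q s a
writes (while c loop p)      s a = writes p s a

∨-falseˡ : ∀ x {y} → x ∨ y ≡ false → x ≡ false
∨-falseˡ false _ = refl

∨-falseʳ : ∀ x {y} → x ∨ y ≡ false → y ≡ false
∨-falseʳ false e = e

Frame : Program → Store → Store → Set
Frame p σ τ = ∀ s a → writes p s a ≡ false → ∀ i → τ s a i ≡ σ s a i

update-frame : ∀ s a i x σ s′ a′ → (s == s′) ∧ does (a ℕ.≟ a′) ≡ false →
               ∀ j → update s a i x σ s′ a′ j ≡ σ s′ a′ j
update-frame nat a i x σ nat a′ e j rewrite e = refl
update-frame nat a i x σ rat a′ e j = refl
update-frame rat a i x σ nat a′ e j = refl
update-frame rat a i x σ rat a′ e j rewrite e = refl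

≟-same : ∀ m → does (m ℕ.≟ m) ≡ true
≟-same m = cong does (ℕ.≟-diag {m} refl)

≟-other : ∀ {i j} → i ≢ j → does (i ℕ.≟ j) ≡ false
≟-other {i} {j} i≢j = dec-false (i ℕ.≟ j) i≢j

update-same : ∀ s a i x σ → update s a i x σ s a i ≡ x
update-same nat a i x σ rewrite ≟-same a | ≟-same i = refl
update-same rat a i x σ rewrite ≟-same a | ≟-same i = refl

update-other : ∀ s a x σ {i j} → i ≢ j → update s a i x σ s a j ≡ σ s a j
update-other nat a x σ i≢j rewrite ≟-same a | ≟-other i≢j = refl
update-other rat a x σ i≢j rewrite ≟-same a | ≟-other i≢j = refl

frame : ∀ {p σ τ t} → ⟨ p , σ ⟩⇓⟨ τ , t ⟩ → Frame p σ τ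
frame ⇓-skip s a e i = refl
frame {σ = σ} (⇓-write {s′} {a′} {ix} {ex}) s a e i =
  update-frame s′ a′ (eval ix σ) (eval ex σ) σ s a e i
frame (⇓-seq {p} d d′) s a e i =
  trans (frame d′ s a (∨-falseʳ (writes p s a) e) i) (frame d s a (∨-falseˡ (writes p s a) e) i)
frame (⇓-then {p = p} _ d) s a e i = frame d s a (∨-falseˡ (writes p s a) e) i
frame (⇓-else {p = p} _ d) s a e i = frame d s a (∨-falseʳ (writes p s a) e) i
frame (⇓-done _) s a e i = refl
frame (⇓-loop _ d d′) s a e i = trans (frame d′ s a e i) (frame d s a e i)

-- The propositional reading of `test`: branches and loop bodies receive usable hypotheses instead
-- of Boolean equations.
Holds : Cond → Store → Set
Holds (_≤ᶜ_ {nat} e f) σ = eval e σ ℕ.≤ eval f σ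
Holds (_≤ᶜ_ {rat} e f) σ = eval e σ ℚ.≤ eval f σ
Holds (notᶜ c) σ = ¬ Holds c σ
Holds (c ∧ᶜ d) σ = Holds c σ × Holds d σ

holds? : ∀ c σ → Dec (Holds c σ)
holds? (_≤ᶜ_ {nat} e f) σ = eval e σ ℕ.≤? eval f σ
holds? (_≤ᶜ_ {rat} e f) σ = eval e σ ℚ.≤? eval f σ
holds? (notᶜ c) σ = ¬? (holds? c σ)
holds? (c ∧ᶜ d) σ = holds? c σ ×-dec holds? d σ

test≡does : ∀ c σ → test c σ ≡ does (holds? c σ)
test≡does (_≤ᶜ_ {nat} e f) σ = refl
test≡does (_≤ᶜ_ {rat} e f) σ = refl
test≡does (notᶜ c) σ = cong not (test≡does c σ)
test≡does (c ∧ᶜ d) σ = cong₂ _∧_ (test≡does c σ) (test≡does d σ)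

-- The time bound depends on the program text only: it presupposes that every
-- loop makes at most n iterations.
record Run (n : ℕ) (p : Program) (σ : Store) (Q : Store → Set) : Set where
  constructor ran
  field
    {final} : Store
    {time}  : ℕ
    halts   : ⟨ p , σ ⟩⇓⟨ final , time ⟩
    bounded : time ℕ.≤ size p ℕ.* n ℕ.^ depth p
    post    : Q final

module _ {n : ℕ} {{n≢0 : NonZero n}} where

  private
    grow : ∀ s {d e} → d ℕ.≤ e → s ℕ.* n ℕ.^ d ℕ.≤ s ℕ.* n ℕ.^ e
    grow s d≤e = ℕ.*-monoʳ-≤ s (ℕ.^-monoʳ-≤ n d≤e)

    weaken : ∀ s d → s ℕ.≤ s ℕ.* n ℕ.^ d
    weaken s d = subst (ℕ._≤ s ℕ.* n ℕ.^ d) (ℕ.*-identityʳ s) (grow s {0} {d} z≤n)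

    branch : ∀ {t s S d D C} → t ℕ.≤ s ℕ.* n ℕ.^ d → s ℕ.≤ S → d ℕ.≤ D →
             C ℕ.+ t ℕ.≤ (C ℕ.+ S) ℕ.* n ℕ.^ D
    branch {S = S} {D = D} {C} t≤ s≤S d≤D = ℕ.≤-trans
      (ℕ.+-mono-≤ (weaken C D) (ℕ.≤-trans t≤ (ℕ.*-mono-≤ s≤S (ℕ.^-monoʳ-≤ n d≤D))))
      (ℕ.≤-reflexive (sym (ℕ.*-distribʳ-+ (n ℕ.^ D) C S)))

  run-conseq : ∀ {p σ} {P Q : Store → Set} → Run n p σ P →
               (∀ {τ} → Frame p σ τ → P τ → Q τ) → Run n p σ Q
  run-conseq (ran d b q) f = ran d b (f (frame d) q)

  run-skip : ∀ {σ} {Q : Store → Set} → Q σ → Run n skip σ Q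
  run-skip q = ran ⇓-skip (weaken 1 0) q

  run-write : ∀ {s a i e σ} {Q : Store → Set} →
              Q (update s a (eval i σ) (eval e σ) σ) → Run n (write s a i e) σ Q
  run-write q = ran ⇓-write (weaken _ 0) q

  infixr 5 _then_
  _then_ : ∀ {p q σ} {P Q : Store → Set} → Run n p σ P →
           (∀ {τ} → Frame p σ τ → P τ → Run n q τ Q) → Run n (p ⨾ q) σ Q
  _then_ {p} {q} {σ} (ran d b r) f with f (frame d) r
  ... | ran d′ b′ r′ = ran (⇓-seq d d′)
    (ℕ.≤-trans (ℕ.+-mono-≤ (ℕ.≤-trans b (grow (size p) (ℕ.m≤m⊔n (depth p) (depth q))))
                            (ℕ.≤-trans b′ (grow (size q) (ℕ.m≤n⊔m (depth p) (depth q)))))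
               (ℕ.≤-reflexive (sym (ℕ.*-distribʳ-+ (n ℕ.^ (depth p ℕ.⊔ depth q)) (size p) (size q)))))
    r′

  run-if : ∀ {c p q σ} {Q : Store → Set} → (Holds c σ → Run n p σ Q) → (¬ Holds c σ → Run n q σ Q) →
           Run n (ifᵖ c then p else q) σ Q
  run-if {c} {p} {q} {σ} f g with holds? c σ | test≡does c σ
  ... | yes h | e = let ran d b r = f h in ran (⇓-then e d)
    (branch b (ℕ.m≤m+n (size p) (size q)) (ℕ.m≤m⊔n (depth p) (depth q))) r
  ... | no ¬h | e = let ran d b r = g ¬h in ran (⇓-else e d)
    (branch b (ℕ.m≤n+m (size q) (size p)) (ℕ.m≤n⊔m (depth p) (depth q))) r

  -- The index of `Inv` is fuel: it starts at `n`, drops in every iteration and refutes the guard at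
  -- 0. It thus yields termination and the factor `n` at once. The body also gets the frame relative
  -- to `σ₀`, so that invariants can be silent about memory that the loop leaves alone.
  run-while : ∀ {c p σ₀} (Inv : ℕ → Store → Set) → Inv n σ₀ →
              (∀ {σ} → Inv 0 σ → ¬ Holds c σ) →
              (∀ {m σ} → Frame p σ₀ σ → Holds c σ → Inv (suc m) σ → Run n p σ (Inv m)) →
              Run n (while c loop p) σ₀ (λ τ → ¬ Holds c τ × ∃[ m ] Inv m τ)
  run-while {c} {p} {σ₀} Inv inv₀ stop step =
    let τ , t , d , b , r = iterate n (λ _ _ _ _ → refl) inv₀ in ran d (ℕ.≤-trans b total) r
    where
    C B : ℕ
    C = suc (costᶜ c)
    B = size p ℕ.* n ℕ.^ depth p

    iterate : ∀ m {σ} → Frame p σ₀ σ → Inv m σ →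
      ∃[ τ ] ∃[ t ] (⟨ while c loop p , σ ⟩⇓⟨ τ , t ⟩ × t ℕ.≤ m ℕ.* (C ℕ.+ B) ℕ.+ C ×
                     ¬ Holds c τ × ∃[ m′ ] Inv m′ τ)
    iterate m {σ} fr inv with holds? c σ | test≡does c σ
    ... | no ¬h | e = σ , C , ⇓-done e , ℕ.m≤n+m C _ , ¬h , m , inv
    iterate zero fr inv | yes h | e = contradiction h (stop inv)
    iterate (suc m) fr inv | yes h | e =
      let ran d b inv′ = step fr h inv
          τ , t , d′ , b′ , r = iterate m (λ s a e i → trans (frame d s a e i) (fr s a e i)) inv′
      in τ , _ , ⇓-loop e d d′ ,
         ℕ.≤-trans (ℕ.+-monoʳ-≤ C (ℕ.+-mono-≤ b b′))
           (ℕ.≤-reflexive (trans (cong (C ℕ.+_) (sym (ℕ.+-assoc B _ C)))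
             (sym (trans (ℕ.+-assoc (C ℕ.+ B) _ C) (trans (ℕ.+-assoc C B _)
               (cong (C ℕ.+_) (sym (ℕ.+-assoc B _ C)))))))) , r

    total : n ℕ.* (C ℕ.+ B) ℕ.+ C ℕ.≤ ((C ℕ.+ C) ℕ.+ size p) ℕ.* (n ℕ.* n ℕ.^ depth p)
    total = begin
      n ℕ.* (C ℕ.+ B) ℕ.+ C                   ≡⟨ cong (ℕ._+ C) (ℕ.*-distribˡ-+ n C B) ⟩
      (n ℕ.* C ℕ.+ n ℕ.* B) ℕ.+ C             ≡⟨ ℕ.+-assoc (n ℕ.* C) _ C ⟩
      n ℕ.* C ℕ.+ (n ℕ.* B ℕ.+ C)             ≡⟨ cong (n ℕ.* C ℕ.+_) (ℕ.+-comm (n ℕ.* B) C) ⟩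
      n ℕ.* C ℕ.+ (C ℕ.+ n ℕ.* B)             ≡⟨ ℕ.+-assoc (n ℕ.* C) C _ ⟨
      n ℕ.* C ℕ.+ C ℕ.+ n ℕ.* B
        ≤⟨ ℕ.+-mono-≤ (ℕ.+-mono-≤ nC≤ (weaken C (suc (depth p)))) (ℕ.≤-reflexive nB) ⟩
      C ℕ.* X ℕ.+ C ℕ.* X ℕ.+ size p ℕ.* X    ≡⟨ cong (ℕ._+ size p ℕ.* X) (ℕ.*-distribʳ-+ X C C) ⟨
      (C ℕ.+ C) ℕ.* X ℕ.+ size p ℕ.* X        ≡⟨ ℕ.*-distribʳ-+ X (C ℕ.+ C) (size p) ⟨
      ((C ℕ.+ C) ℕ.+ size p) ℕ.* X            ∎
      where
      open ℕ.≤-Reasoning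
      X : ℕ
      X = n ℕ.* n ℕ.^ depth p
      nC≤ : n ℕ.* C ℕ.≤ C ℕ.* X
      nC≤ = ℕ.≤-trans (ℕ.≤-reflexive (ℕ.*-comm n C)) (ℕ.*-monoʳ-≤ C (weaken n (depth p)))
      nB : n ℕ.* B ≡ size p ℕ.* X
      nB = trans (sym (ℕ.*-assoc n (size p) _)) (trans (cong (ℕ._* n ℕ.^ depth p) (ℕ.*-comm n (size p)))
             (ℕ.*-assoc (size p) n _))

-- Counting loops

var : ℕ → Exp nat
var a = read nat a (lit 0)

-- Cell 0 of array 0 holds the number of vertices.
forᵖ : ℕ → Program → Program
forᵖ x p = write nat x (lit 0) (lit 0) ⨾
           (while ((var x ⊕ lit 1) ≤ᶜ var 0) loop (p ⨾ write nat x (lit 0) (var x ⊕ lit 1)))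

module _ {n : ℕ} {{n≢0 : NonZero n}} where

  -- Counters have the form `suc x`, so that incrementing one cannot overwrite the number of
  -- vertices in array 0. The stability hypothesis says that `Inv` does not look at the counter; it
  -- usually holds by `id`.
  run-for : ∀ {x p σ₀} (Inv : ℕ → Store → Set) →
            writes p nat (suc x) ≡ false → writes p nat 0 ≡ false →
            σ₀ nat 0 0 ≡ n →
            (∀ {i j σ} → Inv i σ → Inv i (update nat (suc x) 0 j σ)) →
            Inv 0 σ₀ →
            (∀ {σ} (i : Fin n) → Frame (forᵖ (suc x) p) σ₀ σ → σ nat (suc x) 0 ≡ toℕ i →
               Inv (toℕ i) σ → Run n p σ (Inv (suc (toℕ i)))) →
            Run n (forᵖ (suc x) p) σ₀ (Inv n)
  run-for {x} {p} {σ₀} Inv px p0 N stable inv₀ step =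
    run-write {Q = _≡_ (update nat (suc x) 0 0 σ₀)} refl then λ { _ refl →
      run-conseq
        (run-while Inv′ (0 , ℕ.+-identityʳ n , cnt0 , N , stable inv₀) stop body)
        λ { _ (¬h , m , i , m+i , xi , τN , inv) → finish ¬h m+i xi τN inv } }
    where
    Inv′ : ℕ → Store → Set
    Inv′ m σ = ∃[ i ] (m ℕ.+ i ≡ n × σ nat (suc x) 0 ≡ i × σ nat 0 0 ≡ n × Inv i σ)

    reset : ∀ j σ → update nat (suc x) 0 j σ nat (suc x) 0 ≡ j
    reset j σ = update-same nat (suc x) 0 j σ

    cnt0 = reset 0 σ₀

    stop : ∀ {σ} → Inv′ 0 σ → ¬ (σ nat (suc x) 0 ℕ.+ 1 ℕ.≤ σ nat 0 0)
    stop (i , refl , xi , N′ , _) h rewrite xi | N′ = ℕ.m+1+n≰m i h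

    finish : ∀ {m i σ} → ¬ (σ nat (suc x) 0 ℕ.+ 1 ℕ.≤ σ nat 0 0) → m ℕ.+ i ≡ n →
             σ nat (suc x) 0 ≡ i → σ nat 0 0 ≡ n → Inv i σ → Inv n σ
    finish {zero} ¬h refl xi N′ inv = inv
    finish {suc m} {i} ¬h m+i xi N′ inv = contradiction
      (subst₂ ℕ._≤_ (trans (ℕ.+-comm 1 i) (cong (ℕ._+ 1) (sym xi))) (trans m+i (sym N′)) (s≤s (ℕ.m≤n+m i m))) ¬h

    body : ∀ {m σ} → _ → _ → Inv′ (suc m) σ → Run n _ σ (Inv′ m)
    body {m} {σ} fr h (i , m+i , xi , N′ , inv) =
      step (fromℕ< i<n)
           (λ s a e j → trans (fr s a (shuffle s a e) j) (update-frame nat (suc x) 0 0 σ₀ s a (∨-falseˡ _ e) j))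
           (trans xi (sym ti))
           (subst (λ z → Inv z σ) (sym ti) inv)
      then λ {τ} fr′ inv′ →
      run-write (suc i , trans (ℕ.+-suc m i) m+i ,
        trans (reset _ τ) (trans (cong (ℕ._+ 1) (trans (fr′ nat (suc x) px 0) xi)) (ℕ.+-comm i 1)) ,
        trans (fr′ nat 0 p0 0) N′ ,
        stable (subst (λ z → Inv (suc z) τ) ti inv′))
      where
      i<n : i ℕ.< n
      i<n = subst (suc i ℕ.≤_) m+i (s≤s (ℕ.m≤n+m i m))
      ti : toℕ (fromℕ< i<n) ≡ i
      ti = Fin.toℕ-fromℕ< i<n
      shuffle : ∀ s a → writes (forᵖ (suc x) p) s a ≡ false →
                writes (p ⨾ write nat (suc x) (lit 0) (var (suc x) ⊕ lit 1)) s a ≡ false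
      shuffle s a e = ∨-falseʳ ((nat == s) ∧ does (suc x ℕ.≟ a)) e

-- Weights and cardinalities of subsets

Pred : ℕ → Set
Pred n = Fin n → Bool

⁅_⁆ : ∀ {n} → Fin n → Pred n
⁅ r ⁆ v = does (r Fin.≟ v)

-- Over an arbitrary commutative monoid, since cardinalities and weights of vertex sets obey the
-- same additivity.
module Subsum (M : CommutativeMonoid 0ℓ 0ℓ) where
  open CommutativeMonoid M
    renaming (refl to ≈-refl; sym to ≈-sym; trans to ≈-trans; reflexive to ≈-reflexive; ε to 0#)
  open Sum M using (sum; sum-cong-≋; sum-cong-≗; ∑-distrib-+; sum-replicate-zero)

  subsum : ∀ {n} → (Fin n → Carrier) → Pred n → Carrier
  subsum f p = sum λ v → if p v then f v else 0#

  subsum-cong : ∀ {n} f {p q : Pred n} → (∀ v → p v ≡ q v) → subsum f p ≡ subsum f q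
  subsum-cong f p≗q = sum-cong-≗ λ v → cong (λ b → if b then f v else 0#) (p≗q v)

  subsum-∅ : ∀ {n} f {p : Pred n} → (∀ v → p v ≡ false) → subsum f p ≈ 0#
  subsum-∅ {n} f {p} p∅ = ≈-trans
    (≈-reflexive (sum-cong-≗ λ v → cong (λ b → if b then f v else 0#) (p∅ v))) (sum-replicate-zero n)

  subsum-⊎ : ∀ {n} f {p q r : Pred n} → (∀ v → r v ≡ p v ∨ q v) → (∀ v → p v ≡ true → q v ≡ false) →
             subsum f r ≈ subsum f p ∙ subsum f q
  subsum-⊎ f {p} {q} {r} r≗p∨q disjoint = ≈-trans
    (sum-cong-≋ λ v → cell v (p v) refl)
    (∑-distrib-+ (λ v → if p v then f v else 0#) (λ v → if q v then f v else 0#))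
    where
    cell : ∀ v b → p v ≡ b → (if r v then f v else 0#) ≈ (if p v then f v else 0#) ∙ (if q v then f v else 0#)
    cell v true  e rewrite r≗p∨q v | e | disjoint v e = ≈-sym (identityʳ (f v))
    cell v false e rewrite r≗p∨q v | e = ≈-sym (identityˡ _)

  subsum-⁅⁆ : ∀ {n} f (r : Fin n) → subsum f ⁅ r ⁆ ≈ f r
  subsum-⁅⁆ f zero    = ≈-trans (∙-congˡ (subsum-∅ (f ∘ suc) λ _ → refl)) (identityʳ (f zero))
  subsum-⁅⁆ f (suc r) = ≈-trans (identityˡ _) (subsum-⁅⁆ (f ∘ suc) r)

_⊆ᵇ_ : ∀ {n} → Pred n → Pred n → Set
p ⊆ᵇ q = ∀ v → p v ≡ true → q v ≡ true

private
  _∖_ : ∀ {n} → Pred n → Pred n → Pred n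
  (q ∖ p) v = q v ∧ not (p v)

  ∖-∨ : ∀ {n} {p q : Pred n} → p ⊆ᵇ q → ∀ v → q v ≡ p v ∨ (q ∖ p) v
  ∖-∨ {p = p} {q} p⊆q v with p v in e | q v in e′
  ... | true  | true  = refl
  ... | true  | false = trans (sym e′) (p⊆q v e)
  ... | false | true  = refl
  ... | false | false = refl

  ∖-disjoint : ∀ {n} {p q : Pred n} → ∀ v → p v ≡ true → (q ∖ p) v ≡ false
  ∖-disjoint {q = q} v e rewrite e with q v
  ... | true  = refl
  ... | false = refl

module Count = Subsum ℕ.+-0-commutativeMonoid

# : ∀ {n} → Pred n → ℕ
# = Count.subsum (λ _ → 1)

#-mono : ∀ {n} {p q : Pred n} → p ⊆ᵇ q → # p ℕ.≤ # q
#-mono {p = p} {q} p⊆q = subst (# p ℕ.≤_)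
  (sym (Count.subsum-⊎ _ {p} {q ∖ p} {q} (∖-∨ p⊆q) (∖-disjoint {p = p} {q}))) (ℕ.m≤m+n (# p) _)

#-insert : ∀ {n} {p q : Pred n} r → (∀ v → q v ≡ ⁅ r ⁆ v ∨ p v) → p r ≡ false → # q ≡ suc (# p)
#-insert {p = p} {q} r q≗ pr = trans
  (Count.subsum-⊎ _ {⁅ r ⁆} {p} {q} q≗ disjoint) (cong (ℕ._+ # p) (Count.subsum-⁅⁆ (λ _ → 1) r))
  where
  disjoint : ∀ v → ⁅ r ⁆ v ≡ true → p v ≡ false
  disjoint v e with r Fin.≟ v
  ... | yes refl = pr

#-insert-≤ : ∀ {n} {p q : Pred n} r → (∀ v → q v ≡ ⁅ r ⁆ v ∨ p v) → # q ℕ.≤ suc (# p)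
#-insert-≤ {p = p} {q} r q≗ with p r in e
... | false = ℕ.≤-reflexive (#-insert {p = p} r q≗ e)
... | true  = ℕ.m≤n⇒m≤1+n (#-mono {p = q} {p} λ v qv → absorbed v qv)
  where
  absorbed : ∀ v → q v ≡ true → p v ≡ true
  absorbed v qv with r Fin.≟ v | q≗ v
  ... | yes refl | _ = e
  ... | no _     | f = trans (sym f) qv

#-full : ∀ n → # {n} (λ _ → true) ≡ n
#-full zero    = refl
#-full (suc n) = cong suc (#-full n)

#-positive : ∀ {n} {p : Pred n} r → p r ≡ true → 0 ℕ.< # p
#-positive {p = p} r pr = subst (ℕ._≤ # p) (Count.subsum-⁅⁆ (λ _ → 1) r) (#-mono {p = ⁅ r ⁆} {p} incl)
  where
  incl : ∀ v → ⁅ r ⁆ v ≡ true → p v ≡ true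
  incl v e with r Fin.≟ v
  ... | yes refl = pr

#-strict : ∀ {n} {p q : Pred n} r → p ⊆ᵇ q → p r ≡ false → q r ≡ true → # p ℕ.< # q
#-strict {p = p} {q} r p⊆q pr qr = subst (ℕ._≤ # q) (#-insert {p = p} r (λ _ → refl) pr)
  (#-mono {p = λ v → ⁅ r ⁆ v ∨ p v} {q} incl)
  where
  incl : ∀ v → (⁅ r ⁆ v ∨ p v) ≡ true → q v ≡ true
  incl v e with r Fin.≟ v
  ... | yes refl = qr
  ... | no _     = p⊆q v e

-- If no such `v` existed, `q` would be contained in `p`.
pigeonhole : ∀ {n} {p q : Pred n} → # p ℕ.< # q → ∃[ v ] (q v ≡ true × p v ≡ false)
pigeonhole {p = p} {q} p<q with Fin.any? (λ v → (q v Bool.≟ true) ×-dec (p v Bool.≟ false))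
... | yes found = found
... | no  none  = contradiction (#-mono {p = q} {p} incl) (ℕ.<⇒≱ p<q)
  where
  incl : ∀ v → q v ≡ true → p v ≡ true
  incl v qv with p v in e
  ... | true  = refl
  ... | false = contradiction (v , qv , e) none

image : ∀ {k n} → (Fin k → Fin n) → Pred n
image {zero}  h v = false
image {suc k} h v = ⁅ h zero ⁆ v ∨ image (h ∘ suc) v

image-∋ : ∀ {k n} (h : Fin k → Fin n) i → image h (h i) ≡ true
image-∋ h zero    rewrite dec-true (h zero Fin.≟ h zero) refl = refl
image-∋ h (suc i) with does (h zero Fin.≟ h (suc i))
... | true  = refl
... | false = image-∋ (h ∘ suc) i

#-image : ∀ {k n} (h : Fin k → Fin n) → # (image h) ℕ.≤ k
#-image {zero} {n} h = ℕ.≤-reflexive (Count.subsum-∅ {n} (λ _ → 1) λ _ → refl)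
#-image {suc k} h = ℕ.≤-trans (#-insert-≤ {p = image (h ∘ suc)} (h zero) λ _ → refl) (s≤s (#-image (h ∘ suc)))

-- Ranks within a subset

below : ∀ {n} → Pred n → ℕ → Pred n
below p i v = does (toℕ v ℕ.<? i) ∧ p v

-- On the members of `p` this is the increasing bijection onto the numbers below `# p`. Applied to
-- live labels, it renumbers the classes by `Fin k`.
rank : ∀ {n} → Pred n → ℕ → ℕ
rank p i = # (below p i)

below-full : ∀ {n} (p : Pred n) v → below p n v ≡ p v
below-full {n} p v rewrite dec-true (toℕ v ℕ.<? n) (Fin.toℕ<n v) = refl

rank-full : ∀ {n} (p : Pred n) → rank p n ≡ # p
rank-full p = Count.subsum-cong (λ _ → 1) (below-full p)

below-0 : ∀ {n} (p : Pred n) v → below p 0 v ≡ false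
below-0 p v = refl

below-suc : ∀ {n} (p : Pred n) (r v : Fin n) → p r ≡ true →
            below p (suc (toℕ r)) v ≡ ⁅ r ⁆ v ∨ below p (toℕ r) v
below-suc p r v pr with r Fin.≟ v
... | yes refl rewrite dec-true (toℕ r ℕ.<? suc (toℕ r)) ℕ.≤-refl = pr
... | no r≢v with toℕ v ℕ.<? toℕ r
...   | yes v<r rewrite dec-true (toℕ v ℕ.<? toℕ r) v<r
                      | dec-true (toℕ v ℕ.<? suc (toℕ r)) (ℕ.m<n⇒m<1+n v<r) = refl
...   | no  v≮r rewrite dec-false (toℕ v ℕ.<? toℕ r) v≮r | dec-false (toℕ v ℕ.<? suc (toℕ r))
          (λ v<1+r → r≢v (Fin.toℕ-injective (sym (ℕ.≤-antisym (ℕ.s≤s⁻¹ v<1+r) (ℕ.≮⇒≥ v≮r))))) = refl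

below-self : ∀ {n} (p : Pred n) (r : Fin n) → below p (toℕ r) r ≡ false
below-self p r rewrite dec-false (toℕ r ℕ.<? toℕ r) (ℕ.<-irrefl refl) = refl

rank-step : ∀ {n} (p : Pred n) (r : Fin n) → p r ≡ true → rank p (suc (toℕ r)) ≡ suc (rank p (toℕ r))
rank-step p r pr = #-insert {p = below p (toℕ r)} r (λ v → below-suc p r v pr) (below-self p r)

rank-skip : ∀ {n} (p : Pred n) (r : Fin n) → p r ≡ false → rank p (suc (toℕ r)) ≡ rank p (toℕ r)
rank-skip p r pr = Count.subsum-cong (λ _ → 1) cell
  where
  cell : ∀ v → below p (suc (toℕ r)) v ≡ below p (toℕ r) v
  cell v with toℕ v ℕ.<? toℕ r
  ... | yes v<r rewrite dec-true (toℕ v ℕ.<? toℕ r) v<r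
                      | dec-true (toℕ v ℕ.<? suc (toℕ r)) (ℕ.m<n⇒m<1+n v<r) = refl
  ... | no  v≮r with toℕ v ℕ.<? suc (toℕ r)
  ...   | no  v≮1+r rewrite dec-false (toℕ v ℕ.<? toℕ r) v≮r
                          | dec-false (toℕ v ℕ.<? suc (toℕ r)) v≮1+r = refl
  ...   | yes v<1+r with Fin.toℕ-injective {i = v} {r} (ℕ.≤-antisym (ℕ.s≤s⁻¹ v<1+r) (ℕ.≮⇒≥ v≮r))
  ...     | refl rewrite dec-false (toℕ r ℕ.<? toℕ r) v≮r
                       | dec-true (toℕ r ℕ.<? suc (toℕ r)) v<1+r = pr

rank-mono : ∀ {n} (p : Pred n) {i j} → i ℕ.≤ j → rank p i ℕ.≤ rank p j
rank-mono p {i} {j} i≤j = #-mono {p = below p i} {below p j} incl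
  where
  incl : ∀ v → below p i v ≡ true → below p j v ≡ true
  incl v e with toℕ v ℕ.<? i
  ... | yes v<i rewrite dec-true (toℕ v ℕ.<? i) v<i | dec-true (toℕ v ℕ.<? j) (ℕ.<-≤-trans v<i i≤j) = e
  ... | no  v≮i rewrite dec-false (toℕ v ℕ.<? i) v≮i = contradiction e λ ()

rank-< : ∀ {n} (p : Pred n) {r} {j} → p r ≡ true → toℕ r ℕ.< j → rank p (toℕ r) ℕ.< rank p j
rank-< p {r} pr r<j = subst (ℕ._≤ _) (rank-step p r pr) (rank-mono p r<j)

rank-<# : ∀ {n} (p : Pred n) {r} → p r ≡ true → rank p (toℕ r) ℕ.< # p
rank-<# {n} p {r} pr = subst (rank p (toℕ r) ℕ.<_) (rank-full p) (rank-< p pr (Fin.toℕ<n r))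

rank-injective : ∀ {n} (p : Pred n) {r s} → p r ≡ true → p s ≡ true → rank p (toℕ r) ≡ rank p (toℕ s) → r ≡ s
rank-injective p {r} {s} pr ps e with ℕ.<-cmp (toℕ r) (toℕ s)
... | tri< r<s _ _ = contradiction e (ℕ.<⇒≢ (rank-< p pr r<s))
... | tri≈ _ r≡s _ = Fin.toℕ-injective r≡s
... | tri> _ _ s<r = contradiction (sym e) (ℕ.<⇒≢ (rank-< p ps s<r))

-- Passing one index changes the rank by at most one, and only at members of `p`. Going down from
-- `n`, the rank must therefore drop from above `i` to `i` at a member.
rank-surjective : ∀ {n} (p : Pred n) {i} → i ℕ.< # p → ∃[ r ] (p r ≡ true × rank p (toℕ r) ≡ i)
rank-surjective {n} p {i} i<# = go n ℕ.≤-refl (subst (i ℕ.<_) (sym (rank-full p)) i<#)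
  where
  last : ∀ r → i ℕ.< rank p (suc (toℕ r)) → i ℕ.< rank p (toℕ r) ⊎ (p r ≡ true × rank p (toℕ r) ≡ i)
  last r i< with p r in pr
  ... | false = inj₁ (subst (i ℕ.<_) (rank-skip p r pr) i<)
  ... | true with ℕ.m≤n⇒m<n∨m≡n (ℕ.s≤s⁻¹ (subst (i ℕ.<_) (rank-step p r pr) i<))
  ...   | inj₁ i<′ = inj₁ i<′
  ...   | inj₂ i≡  = inj₂ (refl , sym i≡)

  go : ∀ j → j ℕ.≤ n → i ℕ.< rank p j → ∃[ r ] (p r ≡ true × rank p (toℕ r) ≡ i)
  go zero    _   i<  = contradiction (subst (i ℕ.<_) (Count.subsum-∅ {n} (λ _ → 1) (below-0 p)) i<) λ ()
  go (suc j) j<n i<  with last (fromℕ< j<n) (subst (λ j → i ℕ.< rank p (suc j)) (sym (Fin.toℕ-fromℕ< j<n)) i<)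
  ... | inj₁ i<′   = go j (ℕ.<⇒≤ j<n) (subst (λ j → i ℕ.< rank p j) (Fin.toℕ-fromℕ< j<n) i<′)
  ... | inj₂ found = fromℕ< j<n , found

module Weight = Subsum ℚ.+-0-commutativeMonoid

module _ {n : ℕ} {w : Fin n → ℚ} (w≥0 : ∀ v → 0ℚ ℚ.≤ w v) where

  ⟨⟩-nonneg : ∀ p → 0ℚ ℚ.≤ Weight.subsum w p
  ⟨⟩-nonneg p = go (λ v → if p v then w v else 0ℚ) cell
    where
    cell : ∀ v → 0ℚ ℚ.≤ (if p v then w v else 0ℚ)
    cell v with p v
    ... | true  = w≥0 v
    ... | false = ℚ.≤-refl
    go : ∀ {m} (f : Fin m → ℚ) → (∀ v → 0ℚ ℚ.≤ f v) → 0ℚ ℚ.≤ Sum.sum ℚ.+-0-commutativeMonoid f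
    go {zero}  f f≥0 = ℚ.≤-refl
    go {suc m} f f≥0 = ℚ.+-mono-≤ (f≥0 zero) (go (f ∘ suc) (f≥0 ∘ suc))

  ⟨⟩-mono : ∀ {p q} → p ⊆ᵇ q → Weight.subsum w p ℚ.≤ Weight.subsum w q
  ⟨⟩-mono {p} {q} p⊆q = begin
    Weight.subsum w p                                     ≡⟨ ℚ.+-identityʳ _ ⟨
    Weight.subsum w p ℚ.+ 0ℚ                              ≤⟨ ℚ.+-monoʳ-≤ (Weight.subsum w p) (⟨⟩-nonneg (q ∖ p)) ⟩
    Weight.subsum w p ℚ.+ Weight.subsum w (q ∖ p)
      ≡⟨ Weight.subsum-⊎ w {p} {q ∖ p} {q} (∖-∨ p⊆q) (∖-disjoint {p = p} {q}) ⟨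
    Weight.subsum w q                                     ∎
    where open ℚ.≤-Reasoning

-- Labellings

-- Encodes a partition: equal labels mean equal classes. For an idempotent labelling the fixed
-- points are one representative per class, so `count` is the number of classes.
Labelling : ℕ → Set
Labelling n = Fin n → Fin n

cls : ∀ {n} → Labelling n → Fin n → Pred n
cls L r v = does (L v Fin.≟ r)

live : ∀ {n} → Labelling n → Pred n
live L r = does (L r Fin.≟ r)

count : ∀ {n} → Labelling n → ℕ
count L = # (live L)

Idempotent : ∀ {n} → Labelling n → Set
Idempotent L = ∀ v → L (L v) ≡ L v

merge : ∀ {n} → Labelling n → Fin n → Fin n → Labelling n
merge L a b v = if does (L v Fin.≟ b) then a else L v

does⁻ : ∀ {A : Set} (a? : Dec A) → does a? ≡ true → A
does⁻ (yes a) _ = a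

does⁻¬ : ∀ {A : Set} (a? : Dec A) → does a? ≡ false → ¬ A
does⁻¬ (no ¬a) _ = ¬a

module _ {n : ℕ} {L : Labelling n} where

  live⁺ : ∀ {r} → L r ≡ r → live L r ≡ true
  live⁺ {r} = dec-true (L r Fin.≟ r)

  live⁻ : ∀ {r} → live L r ≡ true → L r ≡ r
  live⁻ {r} = does⁻ (L r Fin.≟ r)

  module _ {a b : Fin n} where

    merge-hit : ∀ {v} → L v ≡ b → merge L a b v ≡ a
    merge-hit {v} e rewrite dec-true (L v Fin.≟ b) e = refl

    merge-miss : ∀ {v} → L v ≢ b → merge L a b v ≡ L v
    merge-miss {v} e rewrite dec-false (L v Fin.≟ b) e = refl

    merge-cong : ∀ {u v} → L u ≡ L v → merge L a b u ≡ merge L a b v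
    merge-cong = cong λ l → if does (l Fin.≟ b) then a else l

    merge-cases : ∀ u v → merge L a b u ≡ merge L a b v →
                  L u ≡ L v ⊎ (L u ≡ b × L v ≡ a) ⊎ (L u ≡ a × L v ≡ b)
    merge-cases u v e with L u Fin.≟ b | L v Fin.≟ b
    ... | yes p | yes q = inj₁ (trans p (sym q))
    ... | yes p | no  q = inj₂ (inj₁ (p , sym e))
    ... | no  p | yes q = inj₂ (inj₂ (e , q))
    ... | no  p | no  q = inj₁ e

    merge-idempotent : Idempotent L → L a ≡ a → a ≢ b → Idempotent (merge L a b)
    merge-idempotent idem La a≢b v with L v Fin.≟ b
    ... | yes _    = trans (merge-miss (λ e → a≢b (trans (sym La) e))) La
    ... | no  Lv≢b = trans (merge-miss (λ e → Lv≢b (trans (sym (idem v)) e))) (idem v)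

    -- The fixed points before and after the merge differ in `b` alone.
    count-merge : Idempotent L → L a ≡ a → L b ≡ b → a ≢ b → count L ≡ suc (count (merge L a b))
    count-merge idem La Lb a≢b = #-insert {p = live (merge L a b)} {live L} b cell dead
      where
      dead : live (merge L a b) b ≡ false
      dead rewrite dec-true (L b Fin.≟ b) Lb = dec-false (a Fin.≟ b) a≢b
      cell : ∀ v → live L v ≡ ⁅ b ⁆ v ∨ live (merge L a b) v
      cell v with b Fin.≟ v
      ... | yes refl = dec-true (L b Fin.≟ b) Lb
      ... | no b≢v with L v Fin.≟ b
      ...   | no _ = refl
      ...   | yes Lv≡b rewrite dec-false (L v Fin.≟ v) (λ e → b≢v (trans (sym Lv≡b) e)) =
                sym (dec-false (a Fin.≟ v) λ { refl → a≢b (trans (sym La) Lv≡b) })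

  merge-joins : ∀ u v → merge L (L u) (L v) u ≡ merge L (L u) (L v) v
  merge-joins u v with L u Fin.≟ L v
  ... | yes _ = sym (merge-hit {v = v} refl)
  ... | no  _ = sym (merge-hit {v = v} refl)

  merge-⊆ : ∀ a b x → cls L (L x) ⊆ᵇ cls (merge L a b) (merge L a b x)
  merge-⊆ a b x v e = dec-true (merge L a b v Fin.≟ merge L a b x) (merge-cong (does⁻ (L v Fin.≟ L x) e))

module _ {n : ℕ} (w : Fin n → ℚ) where

  clsWeight : Labelling n → Fin n → ℚ
  clsWeight L r = Weight.subsum w (cls L r)

  module _ {L : Labelling n} {a b : Fin n} (a≢b : a ≢ b) where

    clsWeight-kept : clsWeight (merge L a b) a ≡ clsWeight L a ℚ.+ clsWeight L b
    clsWeight-kept = Weight.subsum-⊎ w {cls L a} {cls L b} {cls (merge L a b) a} cell disjoint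
      where
      cell : ∀ v → cls (merge L a b) a v ≡ cls L a v ∨ cls L b v
      cell v with L v Fin.≟ b
      ... | yes e rewrite dec-true (a Fin.≟ a) refl = sym (Bool.∨-zeroʳ _)
      ... | no  e = sym (Bool.∨-identityʳ _)
      disjoint : ∀ v → cls L a v ≡ true → cls L b v ≡ false
      disjoint v e = dec-false (L v Fin.≟ b) λ f → a≢b (trans (sym (does⁻ (L v Fin.≟ a) e)) f)

    clsWeight-emptied : clsWeight (merge L a b) b ≡ 0ℚ
    clsWeight-emptied = Weight.subsum-∅ w {cls (merge L a b) b} cell
      where
      cell : ∀ v → cls (merge L a b) b v ≡ false
      cell v with L v Fin.≟ b
      ... | yes _ = dec-false (a Fin.≟ b) a≢b
      ... | no  e = dec-false (L v Fin.≟ b) e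

    clsWeight-untouched : ∀ {r} → r ≢ a → r ≢ b → clsWeight (merge L a b) r ≡ clsWeight L r
    clsWeight-untouched {r} r≢a r≢b = Weight.subsum-cong w cell
      where
      cell : ∀ v → cls (merge L a b) r v ≡ cls L r v
      cell v with L v Fin.≟ b
      ... | yes e = trans (dec-false (a Fin.≟ r) (r≢a ∘ sym))
                          (sym (dec-false (L v Fin.≟ r) λ f → r≢b (trans (sym f) e)))
      ... | no  _ = refl

-- Connectedness within classes

module _ {n : ℕ} (R : Rel (Fin n) 0ℓ) where

  LabelPath : Labelling n → Rel (Fin n) 0ℓ
  LabelPath L = Star λ x y → R x y × L x ≡ L y

  Connects : Labelling n → Set
  Connects L = ∀ {u v} → L u ≡ L v → LabelPath L u v

  merge-path : ∀ {L} a b {x y} → LabelPath L x y → LabelPath (merge L a b) x y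
  merge-path {L} a b = Star.map λ (r , e) → r , merge-cong {L = L} e

  -- A path between the two old classes crosses the edge `u v` in one of its directions. `R` is
  -- abstract because the hub search needs paths of eligible edges and the later phases paths of the
  -- graph.
  merge-connects : ∀ {L} → Symmetric R → Connects L → ∀ {u v} → R u v → Connects (merge L (L u) (L v))
  merge-connects {L} R-sym con {u} {v} Ruv {x} {y} e
    with merge-cases {a = L u} {b = L v} x y e
  ... | inj₁ Lx≡Ly = merge-path (L u) (L v) (con Lx≡Ly)
  ... | inj₂ (inj₁ (Lx≡Lv , Ly≡Lu)) =
    merge-path (L u) (L v) (con Lx≡Lv) ◅◅ (R-sym Ruv , sym (merge-joins {L = L} u v)) ◅
    merge-path (L u) (L v) (con (sym Ly≡Lu))
  ... | inj₂ (inj₂ (Lx≡Lu , Ly≡Lv)) =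
    merge-path (L u) (L v) (con Lx≡Lu) ◅◅ (Ruv , merge-joins {L = L} u v) ◅
    merge-path (L u) (L v) (con (sym Ly≡Lv))

-- Merging two classes in memory

update-at : ∀ {n} s a {x y : ⟦ s ⟧} σ {idx} {i v : Fin n} → idx ≡ toℕ i →
            (i ≡ v → x ≡ y) → (i ≢ v → σ s a (toℕ v) ≡ y) → update s a idx x σ s a (toℕ v) ≡ y
update-at s a {x} {y} σ {i = i} {v} refl same other with i Fin.≟ v
... | yes refl = trans (update-same s a (toℕ i) x σ) (same refl)
... | no  i≢v  = trans (update-other s a x σ (i≢v ∘ Fin.toℕ-injective)) (other i≢v)

module _ {n : ℕ} {A : Set} (new old : Fin n → A) where

  -- The contents of an array in the middle of a loop that treats one cell per iteration.
  staged : ℕ → Fin n → A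
  staged i v = if does (toℕ v ℕ.<? i) then new v else old v

  staged-full : ∀ v → staged n v ≡ new v
  staged-full v rewrite dec-true (toℕ v ℕ.<? n) (Fin.toℕ<n v) = refl

  staged-self : ∀ i → staged (toℕ i) i ≡ old i
  staged-self i rewrite dec-false (toℕ i ℕ.<? toℕ i) (ℕ.<-irrefl refl) = refl

  staged-done : ∀ i → staged (suc (toℕ i)) i ≡ new i
  staged-done i rewrite dec-true (toℕ i ℕ.<? suc (toℕ i)) ℕ.≤-refl = refl

  staged-suc : ∀ {i v} → i ≢ v → staged (suc (toℕ i)) v ≡ staged (toℕ i) v
  staged-suc {i} {v} i≢v with toℕ v ℕ.<? toℕ i
  ... | yes v<i rewrite dec-true (toℕ v ℕ.<? toℕ i) v<i
                      | dec-true (toℕ v ℕ.<? suc (toℕ i)) (ℕ.m<n⇒m<1+n v<i) = refl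
  ... | no  v≮i rewrite dec-false (toℕ v ℕ.<? toℕ i) v≮i
                      | dec-false (toℕ v ℕ.<? suc (toℕ i)) (λ v<1+i → i≢v (Fin.toℕ-injective
                          (sym (ℕ.≤-antisym (ℕ.s≤s⁻¹ v<1+i) (ℕ.≮⇒≥ v≮i))))) = refl

module _ {n : ℕ} {{n≢0 : NonZero n}} where

  run-map : ∀ s a {x p σ₀} (new old : Fin n → ⟦ s ⟧) →
            writes p nat (suc x) ≡ false → writes p nat 0 ≡ false → (nat == s) ∧ does (suc x ℕ.≟ a) ≡ false →
            σ₀ nat 0 0 ≡ n → (∀ v → σ₀ s a (toℕ v) ≡ old v) →
            (∀ {σ} (i : Fin n) → Frame (forᵖ (suc x) p) σ₀ σ → σ nat (suc x) 0 ≡ toℕ i → σ s a (toℕ i) ≡ old i →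
               Run n p σ λ τ → τ s a (toℕ i) ≡ new i × (∀ v → i ≢ v → τ s a (toℕ v) ≡ σ s a (toℕ v))) →
            Run n (forᵖ (suc x) p) σ₀ (λ τ → ∀ v → τ s a (toℕ v) ≡ new v)
  run-map s a {x} {p} {σ₀} new old px p0 xa N init step = run-conseq
    (run-for (λ i σ → ∀ v → σ s a (toℕ v) ≡ staged new old i v) px p0 N
      (λ {i} {j} {σ} inv v → trans (update-frame nat (suc x) 0 j σ s a xa (toℕ v)) (inv v))
      init
      λ {σ} i fr X inv → run-conseq (step i fr X (trans (inv i) (staged-self new old i)))
        λ { {τ} _ (at , off) v → cell σ τ v (inv v) at (off v) })
    λ _ done v → trans (done v) (staged-full new old v)
    where
    cell : ∀ {i} σ τ v → σ s a (toℕ v) ≡ staged new old (toℕ i) v → τ s a (toℕ i) ≡ new i →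
           (i ≢ v → τ s a (toℕ v) ≡ σ s a (toℕ v)) → τ s a (toℕ v) ≡ staged new old (suc (toℕ i)) v
    cell {i} σ τ v before at off with i Fin.≟ v
    ... | yes refl = trans at (sym (staged-done new old i))
    ... | no i≢v   = trans (off i≢v) (trans before (sym (staged-suc new old i≢v)))

  run-fill : ∀ s a {x e σ₀} (new : Fin n → ⟦ s ⟧) →
             (s == nat) ∧ does (a ℕ.≟ suc x) ≡ false → (s == nat) ∧ does (a ℕ.≟ 0) ≡ false →
             (nat == s) ∧ does (suc x ℕ.≟ a) ≡ false →
             σ₀ nat 0 0 ≡ n →
             (∀ {σ} (i : Fin n) → Frame (forᵖ (suc x) (write s a (var (suc x)) e)) σ₀ σ →
                σ nat (suc x) 0 ≡ toℕ i → eval e σ ≡ new i) →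
             Run n (forᵖ (suc x) (write s a (var (suc x)) e)) σ₀ (λ τ → ∀ v → τ s a (toℕ v) ≡ new v)
  run-fill s a {x} {e} {σ₀} new ax a0 xa N value =
    run-map s a new (λ v → σ₀ s a (toℕ v)) ax a0 xa N (λ _ → refl)
      λ {σ} i fr X _ → run-write
        ( update-at s a σ X (λ _ → value i fr X) (λ i≢i → contradiction refl i≢i)
        , λ v i≢v → update-at s a σ X (λ i≡v → contradiction i≡v i≢v) (λ _ → refl) )

infix 4 _≐_
_≐_ : Exp nat → Exp nat → Cond
e ≐ f = (e ≤ᶜ f) ∧ᶜ (f ≤ᶜ e)

≐⁺ : ∀ {x y : ℕ} → x ≡ y → x ℕ.≤ y × y ℕ.≤ x
≐⁺ refl = ℕ.≤-refl , ℕ.≤-refl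

≐⁻ : ∀ {x y : ℕ} → x ℕ.≤ y × y ℕ.≤ x → x ≡ y
≐⁻ (p , q) = ℕ.≤-antisym p q

-- A and B hold the surviving and the vanishing label of a merge; H holds the
-- neighbour found by seek and, later, the next class number handed out by emit.
ADJ OUT LAB SIDE C CNT K FLAG U V X A B H RANK : ℕ
ADJ = 1
OUT = 2
LAB = 3
SIDE = 4
C = 5
CNT = 6
K = 7
FLAG = 8
U = 9
V = 10
X = 11
A = 12
B = 13
H = 14
RANK = 15

WT TOTAL T : ℕ
WT = 1
TOTAL = 2
T = 3

lab : Exp nat → Exp nat
lab = read nat LAB

wt : Exp nat → Exp rat
wt = read rat WT

relabel absorb : Program
relabel = forᵖ X (ifᵖ lab (var X) ≐ var B then write nat LAB (var X) (var A) else skip)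
absorb  = write rat WT (var A) (wt (var A) ⊕ wt (var B)) ⨾ write rat WT (var B) (lit 0ℚ) ⨾
          write nat CNT (lit 0) (var CNT ⊖ lit 1) ⨾ relabel

module Merging {n : ℕ} {{n≢0 : NonZero n}} (w : Fin n → ℚ) where

  -- The weights are prescribed at all labels, including vanished ones, whose classes are empty;
  -- `absorb` clears the cell of `B` for this reason.
  Stores : Store → Labelling n → Set
  Stores σ L = (∀ v → σ nat LAB (toℕ v) ≡ toℕ (L v)) × (∀ r → σ rat WT (toℕ r) ≡ clsWeight w L r) ×
               σ nat CNT 0 ≡ count L

  relabel-correct : ∀ {σ L a b} → σ nat 0 0 ≡ n → σ nat A 0 ≡ toℕ a → σ nat B 0 ≡ toℕ b →
                    (∀ v → σ nat LAB (toℕ v) ≡ toℕ (L v)) →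
                    Run n relabel σ (λ τ → ∀ v → τ nat LAB (toℕ v) ≡ toℕ (merge L a b v))
  relabel-correct {σ₀} {L} {a} {b} N a≡ b≡ labels =
    run-map nat LAB (λ v → toℕ (merge L a b v)) (λ v → toℕ (L v)) refl refl refl N labels
      λ {σ} i fr x≡ l≡ → run-if
        (λ h → run-write
          ( update-at nat LAB σ x≡ (λ _ → trans (fr nat A refl 0) (trans a≡
              (cong toℕ (sym (merge-hit {L = L} (Fin.toℕ-injective
                (trans (sym l≡) (trans (cong (σ nat LAB) (sym x≡)) (trans (≐⁻ h) (trans (fr nat B refl 0) b≡))))))))))
              (contradiction refl)
          , λ v i≢v → update-at nat LAB σ x≡ (λ i≡v → contradiction i≡v i≢v) (λ _ → refl) ))
        (λ ¬h → run-skip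
          ( trans l≡ (cong toℕ (sym (merge-miss {L = L} λ Li≡b →
              ¬h (≐⁺ (trans (cong (σ nat LAB) x≡) (trans l≡ (trans (cong toℕ Li≡b) (sym (trans (fr nat B refl 0) b≡)))))))))
          , λ _ _ → refl ))

  absorb-correct : ∀ {σ L a b} → σ nat 0 0 ≡ n → σ nat A 0 ≡ toℕ a → σ nat B 0 ≡ toℕ b →
                   Stores σ L → Idempotent L → L a ≡ a → L b ≡ b → a ≢ b →
                   Run n absorb σ (λ τ → Stores τ (merge L a b))
  absorb-correct {σ} {L} {a} {b} N a≡ b≡ (labels , weights , cnt) idem La Lb a≢b =
    run-write {Q = λ τ → τ ≡ σ₁} refl then λ { _ refl →
    run-write {Q = λ τ → τ ≡ σ₂} refl then λ { _ refl →
    run-write {Q = λ τ → τ ≡ σ₃} refl then λ { _ refl →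
    run-conseq (relabel-correct {L = L} N a≡ b≡ labels) λ fr labels′ →
      labels′ , (λ r → trans (fr rat WT refl (toℕ r)) (weights′ r)) , trans (fr nat CNT refl 0)
        (trans (cong (ℕ._∸ 1) cnt) (cong (ℕ._∸ 1) (count-merge {L = L} idem La Lb a≢b))) } } }
    where
    σ₁ σ₂ σ₃ : Store
    σ₁ = update rat WT (σ nat A 0) (σ rat WT (σ nat A 0) ℚ.+ σ rat WT (σ nat B 0)) σ
    σ₂ = update rat WT (σ nat B 0) 0ℚ σ₁
    σ₃ = update nat CNT 0 (σ nat CNT 0 ℕ.∸ 1) σ₂
    weights′ : ∀ r → σ₂ rat WT (toℕ r) ≡ clsWeight w (merge L a b) r
    weights′ r = update-at rat WT σ₁ b≡
      (λ { refl → sym (clsWeight-emptied w {L} a≢b) })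
      λ b≢r → update-at rat WT σ a≡
        (λ { refl → trans (cong₂ ℚ._+_ (trans (cong (σ rat WT) a≡) (weights a))
                                       (trans (cong (σ rat WT) b≡) (weights b)))
                          (sym (clsWeight-kept w {L} a≢b)) })
        λ a≢r → trans (weights r) (sym (clsWeight-untouched w {L} a≢b (a≢r ∘ sym) (b≢r ∘ sym)))

-- Greedy merging along edges

side : Exp nat → Exp nat
side = read nat SIDE

dbl : ℚ → ℚ
dbl x = x ℚ.+ x

-- Twice the joint weight is compared with the limit T, so that T = 2W never
-- blocks a merge and T = W enforces the bound W/2.
mergeable : Cond
mergeable =
  notᶜ (var U ≐ var C) ∧ᶜ (notᶜ (var V ≐ var C) ∧ᶜ
  ((lit 1 ≤ᶜ read nat ADJ (var U ⊗ var 0 ⊕ var V)) ∧ᶜ ((side (var U) ≐ side (var V)) ∧ᶜ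
  (notᶜ (lab (var U) ≐ lab (var V)) ∧ᶜ (((var K ⊕ lit 1) ≤ᶜ var CNT) ∧ᶜ
  (((wt (lab (var U)) ⊕ wt (lab (var V))) ⊕ (wt (lab (var U)) ⊕ wt (lab (var V)))) ≤ᶜ read rat T (lit 0)))))))

consider scan : Program
consider = ifᵖ mergeable then (write nat A (lit 0) (lab (var U)) ⨾ write nat B (lit 0) (lab (var V)) ⨾ absorb)
           else skip
scan = forᵖ U (forᵖ V consider)

module Scanning {n : ℕ} {{n≢0 : NonZero n}} (G : Graph n) {w : Fin n → ℚ} (w≥0 : ∀ v → 0ℚ ℚ.≤ w v) where
  open Graph G
  open Merging w public

  -- The sides `s` separate the part that contains the hub from what earlier rounds of the hub
  -- search have set aside. For constant `s` the eligible edges are precisely those of `G` without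
  -- `c`.
  Eligible : Fin n → (Fin n → ℕ) → Rel (Fin n) 0ℓ
  Eligible c s u v = u ≢ c × v ≢ c × u ~ v × s u ≡ s v

  Eligible-sym : ∀ {c s} → Symmetric (Eligible c s)
  Eligible-sym (u≢c , v≢c , u~v , e) = v≢c , u≢c , ~-sym u~v , sym e

  pairWeight : Labelling n → Fin n → Fin n → ℚ
  pairWeight L u v = dbl (clsWeight w L (L u) ℚ.+ clsWeight w L (L v))

  Settled : ℕ → ℚ → Labelling n → Fin n → Fin n → Set
  Settled k t L u v = L u ≡ L v ⊎ count L ℕ.≤ k ⊎ t ℚ.< pairWeight L u v

  -- Equal labels stay equal, the count falls and, weights being nonnegative, classes only get
  -- heavier. Hence no pair has to be revisited and a single pass over all pairs suffices.
  settled-merge : ∀ {k t L a b u v} → Idempotent L → L a ≡ a → L b ≡ b → a ≢ b →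
                  Settled k t L u v → Settled k t (merge L a b) u v
  settled-merge {L = L} idem La Lb a≢b (inj₁ e) = inj₁ (merge-cong {L = L} e)
  settled-merge {k} {L = L} idem La Lb a≢b (inj₂ (inj₁ c≤k)) =
    inj₂ (inj₁ (ℕ.≤-trans (ℕ.n≤1+n _) (subst (ℕ._≤ k) (count-merge {L = L} idem La Lb a≢b) c≤k)))
  settled-merge {L = L} {a} {b} {u} {v} idem La Lb a≢b (inj₂ (inj₂ t<)) =
    inj₂ (inj₂ (ℚ.<-≤-trans t< (ℚ.+-mono-≤ grows grows)))
    where
    grows : clsWeight w L (L u) ℚ.+ clsWeight w L (L v) ℚ.≤
            clsWeight w (merge L a b) (merge L a b u) ℚ.+ clsWeight w (merge L a b) (merge L a b v)
    grows = ℚ.+-mono-≤ (⟨⟩-mono w≥0 (merge-⊆ {L = L} a b u)) (⟨⟩-mono w≥0 (merge-⊆ {L = L} a b v))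

  record Setting (σ : Store) (c : Fin n) (s : Fin n → ℕ) (k : ℕ) (t : ℚ) : Set where
    field
      order : σ nat 0 0 ≡ n
      edge  : ∀ u v → σ nat ADJ (toℕ u ℕ.* n ℕ.+ toℕ v) ≡ (if does (u ~? v) then 1 else 0)
      hub   : σ nat C 0 ≡ toℕ c
      sides : ∀ v → σ nat SIDE (toℕ v) ≡ s v
      quota : σ nat K 0 ≡ k
      limit : σ rat T 0 ≡ t

  edge⁺ : ∀ {u v x} → x ≡ (if does (u ~? v) then 1 else 0) → u ~ v → 1 ℕ.≤ x
  edge⁺ {u} {v} e u~v rewrite dec-true (u ~? v) u~v | e = ℕ.≤-refl

  edge⁻ : ∀ {u v x} → x ≡ (if does (u ~? v) then 1 else 0) → 1 ℕ.≤ x → u ~ v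
  edge⁻ {u} {v} e 1≤x with u ~? v
  ... | yes u~v = u~v
  edge⁻ refl () | no _

  module Scan {σ₀ c s k t} (setting : Setting σ₀ c s k t) where
    open Setting setting

    Mergeable : Labelling n → Fin n → Fin n → Set
    Mergeable L u v = Eligible c s u v × L u ≢ L v × k ℕ.< count L × pairWeight L u v ℚ.≤ t

    record Located (σ : Store) (L : Labelling n) (u v : Fin n) : Set where
      field
        frame₀ : ∀ s a → writes scan s a ≡ false → ∀ i → σ s a i ≡ σ₀ s a i
        at-u   : σ nat U 0 ≡ toℕ u
        at-v   : σ nat V 0 ≡ toℕ v
        stores : Stores σ L

      order′ : σ nat 0 0 ≡ n
      order′ = trans (frame₀ nat 0 refl 0) order
      hub′ : σ nat C 0 ≡ toℕ c
      hub′ = trans (frame₀ nat C refl 0) hub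
      edge′ : σ nat ADJ (σ nat U 0 ℕ.* σ nat 0 0 ℕ.+ σ nat V 0) ≡ (if does (u ~? v) then 1 else 0)
      edge′ = trans (cong₂ (λ a b → σ nat ADJ (a ℕ.+ b)) (cong₂ ℕ._*_ at-u order′) at-v)
                    (trans (frame₀ nat ADJ refl _) (edge u v))
      side-u : σ nat SIDE (σ nat U 0) ≡ s u
      side-u = trans (cong (σ nat SIDE) at-u) (trans (frame₀ nat SIDE refl _) (sides u))
      side-v : σ nat SIDE (σ nat V 0) ≡ s v
      side-v = trans (cong (σ nat SIDE) at-v) (trans (frame₀ nat SIDE refl _) (sides v))
      lab-u : σ nat LAB (σ nat U 0) ≡ toℕ (L u)
      lab-u = trans (cong (σ nat LAB) at-u) (proj₁ stores u)
      lab-v : σ nat LAB (σ nat V 0) ≡ toℕ (L v)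
      lab-v = trans (cong (σ nat LAB) at-v) (proj₁ stores v)
      quota′ : σ nat K 0 ℕ.+ 1 ≡ suc k
      quota′ = trans (cong (ℕ._+ 1) (trans (frame₀ nat K refl 0) quota)) (ℕ.+-comm k 1)
      cnt : σ nat CNT 0 ≡ count L
      cnt = proj₂ (proj₂ stores)
      pair : dbl (σ rat WT (σ nat LAB (σ nat U 0)) ℚ.+ σ rat WT (σ nat LAB (σ nat V 0))) ≡ pairWeight L u v
      pair = cong dbl (cong₂ ℚ._+_ (trans (cong (σ rat WT) lab-u) (proj₁ (proj₂ stores) (L u)))
                                   (trans (cong (σ rat WT) lab-v) (proj₁ (proj₂ stores) (L v))))
      limit′ : σ rat T 0 ≡ t
      limit′ = trans (frame₀ rat T refl 0) limit

      decode : Holds mergeable σ → Mergeable L u v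
      decode (u≢c , v≢c , adj , s≡ , l≢ , k< , p≤) =
        ( (λ { refl → u≢c (≐⁺ (trans at-u (sym hub′))) })
        , (λ { refl → v≢c (≐⁺ (trans at-v (sym hub′))) })
        , edge⁻ edge′ adj
        , trans (sym side-u) (trans (≐⁻ s≡) side-v) )
        , (λ e → l≢ (≐⁺ (trans lab-u (trans (cong toℕ e) (sym lab-v)))))
        , subst₂ ℕ._≤_ quota′ cnt k<
        , subst₂ ℚ._≤_ pair limit′ p≤

      encode : Mergeable L u v → Holds mergeable σ
      encode ((u≢c , v≢c , u~v , s≡) , l≢ , k< , p≤) =
        (λ h → u≢c (Fin.toℕ-injective (trans (sym at-u) (trans (≐⁻ h) hub′)))) ,
        (λ h → v≢c (Fin.toℕ-injective (trans (sym at-v) (trans (≐⁻ h) hub′)))) ,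
        edge⁺ edge′ u~v ,
        ≐⁺ (trans side-u (trans s≡ (sym side-v))) ,
        (λ h → l≢ (Fin.toℕ-injective (trans (sym lab-u) (trans (≐⁻ h) lab-v)))) ,
        subst₂ ℕ._≤_ (sym quota′) (sym cnt) k< ,
        subst₂ ℚ._≤_ (sym pair) (sym limit′) p≤

    settle : ∀ {L u v} → Eligible c s u v → ¬ Mergeable L u v → Settled k t L u v
    settle {L} {u} {v} el ¬m with L u Fin.≟ L v | count L ℕ.≤? k | pairWeight L u v ℚ.≤? t
    ... | yes e | _ | _ = inj₁ e
    ... | no _ | yes c≤k | _ = inj₂ (inj₁ c≤k)
    ... | no _ | no _ | no p≰t = inj₂ (inj₂ (ℚ.≰⇒> p≰t))
    ... | no l≢ | no c≰k | yes p≤t = contradiction (el , l≢ , ℕ.≰⇒> c≰k , p≤t) ¬m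

    module _ (J : Labelling n → Set)
             (J-merge : ∀ {L u v} → J L → Idempotent L → Mergeable L u v → J (merge L (L u) (L v))) where

      Scanned : (Fin n → Fin n → Set) → Store → Set
      Scanned D σ = ∃[ L ] (Stores σ L × Idempotent L × J L × k ℕ.≤ count L ×
                            ∀ u v → D u v → Eligible c s u v → Settled k t L u v)

      -- `J` is whatever the caller wants preserved: connectedness by eligible edges when components
      -- are computed, `Wheel` when classes are balanced. The lower bound on the count survives
      -- because each merge is guarded by a strict inequality.
      scan-correct : ∀ {L} → Stores σ₀ L → Idempotent L → J L → k ℕ.≤ count L →
                     Run n scan σ₀ (Scanned λ _ _ → ⊤)
      scan-correct {L} st idem j k≤ = run-conseq
        (run-for (λ i → Scanned λ u v → toℕ u ℕ.< i) refl refl order id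
          (L , st , idem , j , k≤ , λ _ _ ())
          λ { u fr at-u (L , st , idem , j , k≤ , settled) → run-conseq
            (run-for (λ i → Scanned λ u′ v → toℕ u′ ℕ.< toℕ u ⊎ (u′ ≡ u × toℕ v ℕ.< i)) refl refl
              (trans (fr nat 0 refl 0) order) id
              (L , st , idem , j , k≤ , λ { u v (inj₁ u<) → settled u v u<; u v (inj₂ (_ , ())) })
              λ { v fr′ at-v (L , st , idem , j , k≤ , settled) →
                consider-correct
                  (record { frame₀ = λ s a e i → trans (fr′ s a (unfold s a e) i) (fr s a e i)
                          ; at-u = trans (fr′ nat U refl 0) at-u ; at-v = at-v ; stores = st })
                  idem j k≤ settled })
            λ { _ (L , st , idem , j , k≤ , settled) → L , st , idem , j , k≤ ,
                λ u′ v u′< → settled u′ v (first (ℕ.m<1+n⇒m<n∨m≡n u′<)) } })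
        λ { _ (L , st , idem , j , k≤ , settled) → L , st , idem , j , k≤ , λ u v _ → settled u v (Fin.toℕ<n u) }
        where
        unfold : ∀ s a → writes scan s a ≡ false → writes (forᵖ V consider) s a ≡ false
        unfold s a e = ∨-falseˡ (writes (forᵖ V consider) s a)
          (∨-falseʳ ((nat == s) ∧ does (U ℕ.≟ a)) e)
        first : ∀ {u u′ : Fin n} {v : Fin n} → toℕ u′ ℕ.< toℕ u ⊎ toℕ u′ ≡ toℕ u →
                toℕ u′ ℕ.< toℕ u ⊎ (u′ ≡ u × toℕ v ℕ.< n)
        first (inj₁ u′<u) = inj₁ u′<u
        first {v = v} (inj₂ u′≡u) = inj₂ (Fin.toℕ-injective u′≡u , Fin.toℕ<n v)

        consider-correct : ∀ {σ L u v} → Located σ L u v → Idempotent L → J L → k ℕ.≤ count L →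
          (∀ u′ v′ → toℕ u′ ℕ.< toℕ u ⊎ (u′ ≡ u × toℕ v′ ℕ.< toℕ v) → Eligible c s u′ v′ → Settled k t L u′ v′) →
          Run n consider σ
            (Scanned λ u′ v′ → toℕ u′ ℕ.< toℕ u ⊎ (u′ ≡ u × toℕ v′ ℕ.< suc (toℕ v)))
        consider-correct {σ} {L} {u} {v} loc idem j k≤ settled = run-if
          (λ h → let m@(el , l≢ , k< , p≤) = decode h in
            run-write {Q = λ τ → τ ≡ σ₁} refl then λ { _ refl →
            run-write {Q = λ τ → τ ≡ σ₂} refl then λ { _ refl →
            run-conseq (absorb-correct {L = L} order′ lab-u lab-v stores idem (idem u) (idem v) l≢)
              λ _ st → merge L (L u) (L v) , st , merge-idempotent {L = L} idem (idem u) l≢ , J-merge j idem m ,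
                ℕ.s≤s⁻¹ (subst (suc k ℕ.≤_) (count-merge {L = L} idem (idem u) (idem v) l≢) k<) ,
                λ u′ v′ d → extend (λ b el′ → settled-merge {L = L} idem (idem u) (idem v) l≢ (settled u′ v′ b el′))
                              (λ { refl refl _ → inj₁ (merge-joins {L = L} u v) }) d } })
          (λ ¬h → run-skip (L , stores , idem , j , k≤ ,
            λ u′ v′ d → extend (settled u′ v′) (λ { refl refl el → settle el (¬h ∘ encode) }) d))
          where
          open Located loc
          σ₁ σ₂ : Store
          σ₁ = update nat A 0 (σ nat LAB (σ nat U 0)) σ
          σ₂ = update nat B 0 (σ nat LAB (σ nat V 0)) σ₁
          extend : ∀ {u′ v′} {Y : Set} →
                   (toℕ u′ ℕ.< toℕ u ⊎ (u′ ≡ u × toℕ v′ ℕ.< toℕ v) → Y) → (u′ ≡ u → v′ ≡ v → Y) →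
                   toℕ u′ ℕ.< toℕ u ⊎ (u′ ≡ u × toℕ v′ ℕ.< suc (toℕ v)) → Y
          extend old new (inj₁ b) = old (inj₁ b)
          extend old new (inj₂ (e , v′<)) with ℕ.m<1+n⇒m<n∨m≡n v′<
          ... | inj₁ b  = old (inj₂ (e , b))
          ... | inj₂ e′ = new e (Fin.toℕ-injective e′)

-- Finding the hub

bit : Bool → ℕ
bit b = if b then 1 else 0

<⇒≱ : ∀ {p q} → p ℚ.< q → ¬ q ℚ.≤ p
<⇒≱ p<q q≤p = ℚ.<-irrefl refl (ℚ.<-≤-trans p<q q≤p)

initialise components seek recentre round descend : Program
initialise = forᵖ X (write nat LAB (var X) (var X)) ⨾ forᵖ X (write rat WT (var X) (read rat 0 (var X))) ⨾
             write nat CNT (lit 0) (var 0)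
components = initialise ⨾ scan
-- Testing the neighbours of the hub is enough, since every component contains one of them. `FLAG`
-- is 1 on success; fresh memory holds 0, which makes the loop of `descend` start.
seek       = forᵖ V (ifᵖ (lit 1 ≤ᶜ read nat ADJ (var C ⊗ var 0 ⊕ var V)) ∧ᶜ
                         notᶜ ((wt (lab (var V)) ⊕ wt (lab (var V))) ≤ᶜ read rat TOTAL (lit 0))
                     then (write nat FLAG (lit 0) (lit 0) ⨾ write nat H (lit 0) (var V)) else skip)
recentre   = forᵖ X (ifᵖ lab (var X) ≐ lab (var H) then write nat SIDE (var X) (lit 1)
                                                   else write nat SIDE (var X) (lit 0)) ⨾
             write nat C (lit 0) (var H)
round      = components ⨾ write nat FLAG (lit 0) (lit 1) ⨾ seek ⨾ ifᵖ (var FLAG ≐ lit 0) then recentre else skip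
descend    = while (var FLAG ≐ lit 0) loop round

record Loaded {n : ℕ} (G : Graph n) (w : Fin n → ℚ) (σ : Store) : Set where
  open Graph G
  field
    order   : σ nat 0 0 ≡ n
    edge    : ∀ u v → σ nat ADJ (toℕ u ℕ.* n ℕ.+ toℕ v) ≡ (if does (u ~? v) then 1 else 0)
    masses  : ∀ v → σ rat 0 (toℕ v) ≡ w v

module Descent {n : ℕ} {{n≢0 : NonZero n}} (G : Graph n) {w : Fin n → ℚ} (w≥0 : ∀ v → 0ℚ ℚ.≤ w v) where
  open Graph G
  open Scanning G w≥0 public

  total : ℚ
  total = Weight.subsum w (λ _ → true)

  complement : ∀ (p q : Pred n) → (∀ v → q v ≡ not (p v)) → Weight.subsum w p ℚ.+ Weight.subsum w q ≡ total
  complement p q q≗ = sym (Weight.subsum-⊎ w {p} {q} {λ _ → true} cover disjoint)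
    where
    cover : ∀ v → true ≡ p v ∨ q v
    cover v rewrite q≗ v = sym (Bool.∨-inverseʳ (p v))
    disjoint : ∀ v → p v ≡ true → q v ≡ false
    disjoint v e rewrite q≗ v | e = refl

  pair≤total : ∀ {L : Labelling n} {a b} → a ≢ b → clsWeight w L a ℚ.+ clsWeight w L b ℚ.≤ total
  pair≤total {L} {a} {b} a≢b = ℚ.≤-trans
    (ℚ.≤-reflexive (sym (Weight.subsum-⊎ w {cls L a} {cls L b} {λ v → cls L a v ∨ cls L b v} (λ _ → refl)
      λ v e → dec-false (L v Fin.≟ b) λ f → a≢b (trans (sym (does⁻ (L v Fin.≟ a) e)) f))))
    (⟨⟩-mono w≥0 {λ v → cls L a v ∨ cls L b v} {λ _ → true} λ _ _ → refl)

  count-positive : ∀ {L : Labelling n} → Idempotent L → Fin n → 0 ℕ.< count L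
  count-positive {L} idem v = #-positive {p = live L} (L v) (live⁺ {L = L} (idem v))

  InHub : (Fin n → ℕ) → Fin n → Pred n
  InHub s c v = does (s v ℕ.≟ s c)

  OffHub : (Fin n → ℕ) → Fin n → Pred n
  OffHub s c v = not (InHub s c v)

  -- Paths keep to one side, so that their edges are eligible up to the first visit to the hub. The
  -- exception `z ≡ c` lets the far side, which lies across from the hub, enter it.
  Attached : Fin n → (Fin n → ℕ) → Set
  Attached c s = ∀ x → Star (λ y z → y ~ z × (s y ≡ s z ⊎ z ≡ c)) x c

  LightOff : Fin n → (Fin n → ℕ) → Set
  LightOff c s = dbl (Weight.subsum w (OffHub s c)) ℚ.≤ total

  Closed : Rel (Fin n) 0ℓ → Labelling n → Set
  Closed R L = ∀ {u v} → R u v → L u ≡ L v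

  Spokes : Fin n → Labelling n → Set
  Spokes c L = ∀ x → x ≢ c → ∃[ y ] (L y ≡ L x × y ~ c)

  LightSpokes : Fin n → Labelling n → Set
  LightSpokes c L = ∀ x → x ≢ c → dbl (clsWeight w L (L x)) ℚ.≤ total

  HubAlone : Fin n → Labelling n → Set
  HubAlone c L = ∀ x → L x ≡ L c → x ≡ c

  dbl-mono : ∀ {x y} → x ℚ.≤ y → dbl x ℚ.≤ dbl y
  dbl-mono x≤y = ℚ.+-mono-≤ x≤y x≤y

  other-part-light : ∀ {x y} → x ℚ.+ y ≡ total → total ℚ.< dbl x → dbl y ℚ.≤ total
  other-part-light {x} {y} x+y heavy = ℚ.≮⇒≥ λ t< → ℚ.<-irrefl refl (begin-strict
    total ℚ.+ total   <⟨ ℚ.+-mono-< heavy t< ⟩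
    dbl x ℚ.+ dbl y   ≡⟨ shuffle x y ⟩
    dbl (x ℚ.+ y)     ≡⟨ cong dbl x+y ⟩
    total ℚ.+ total   ∎)
    where
    open ℚ.≤-Reasoning
    shuffle : ∀ x y → (x ℚ.+ x) ℚ.+ (y ℚ.+ y) ≡ (x ℚ.+ y) ℚ.+ (x ℚ.+ y)
    shuffle = solve 2 (λ x y → (x :+ x) :+ (y :+ y) := (x :+ y) :+ (x :+ y)) refl
      where open +-*-Solver

  module _ {c : Fin n} {s : Fin n → ℕ} where

    -- No eligible edge meets the hub, so a path of such edges from it is empty.
    hub-alone : ∀ {L} → Connects (Eligible c s) L → HubAlone c L
    hub-alone con x e with con (sym e)
    ... | ε = refl
    ... | ((c≢c , _) , _) ◅ _ = contradiction refl c≢c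

    -- On a path from `x` to the hub, all edges before the first visit to the hub are eligible. The
    -- vertex just before that visit therefore still has the label of `x`.
    spokes : ∀ {L} → Attached c s → Closed (Eligible c s) L → Spokes c L
    spokes {L} attached closed x x≢c = go (attached x) x≢c
      where
      go : ∀ {x} → Star (λ y z → y ~ z × (s y ≡ s z ⊎ z ≡ c)) x c → x ≢ c → ∃[ y ] (L y ≡ L x × y ~ c)
      go ε x≢c = contradiction refl x≢c
      go (_◅_ {x} {y} (x~y , m) path) x≢c with y Fin.≟ c | m
      ... | yes refl | _ = x , refl , x~y
      ... | no y≢c | inj₂ y≡c = contradiction y≡c y≢c
      ... | no y≢c | inj₁ sx≡sy with go path y≢c
      ...   | z , Lz≡Ly , z~c = z , trans Lz≡Ly (sym (closed (x≢c , y≢c , x~y , sx≡sy))) , z~c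

    -- Two distinct classes together weigh at most the total, so under the limit `dbl total` no pair
    -- is too heavy. Unless the quota intervened, the scan has merged along every eligible edge.
    settled-closed : ∀ {L k} → k ℕ.< count L →
                     (∀ u v → Eligible c s u v → Settled k (dbl total) L u v) → Closed (Eligible c s) L
    settled-closed {L} k< settled {u} {v} el with L u Fin.≟ L v | settled u v el
    ... | yes e | _ = e
    ... | no _ | inj₁ e = e
    ... | no _ | inj₂ (inj₁ c≤k) = contradiction k< (ℕ.≤⇒≯ c≤k)
    ... | no l≢ | inj₂ (inj₂ t<) = contradiction (dbl-mono (pair≤total {L} l≢)) (<⇒≱ t<)

    side-path : ∀ {L u v} → Connects (Eligible c s) L → L u ≡ L v → s u ≡ s v
    side-path con e = go (con e)
      where
      go : ∀ {L u v} → LabelPath (Eligible c s) L u v → s u ≡ s v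
      go ε = refl
      go (((_ , _ , _ , e) , _) ◅ path) = trans e (go path)

    -- Moving the hub to a neighbour h in a heavy class: that class becomes the new near side.
    module Recentring {L : Labelling n} (attached : Attached c s) (light : LightOff c s)
                      (con : Connects (Eligible c s) L) (closed : Closed (Eligible c s) L)
                      {h : Fin n} (c~h : c ~ h) (heavy : total ℚ.< dbl (clsWeight w L (L h))) where

      s′ : Fin n → ℕ
      s′ x = if does (L x Fin.≟ L h) then 1 else 0

      h≢c : h ≢ c
      h≢c refl = ~-irrefl refl c~h

      s′-near : ∀ {x} → L x ≡ L h → s′ x ≡ 1
      s′-near {x} e rewrite dec-true (L x Fin.≟ L h) e = refl

      s′-far : ∀ {x} → L x ≢ L h → s′ x ≡ 0
      s′-far {x} e rewrite dec-false (L x Fin.≟ L h) e = refl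

      Lc≢Lh : L c ≢ L h
      Lc≢Lh e = h≢c (hub-alone con h (sym e))

      lift : ∀ {x y} → LabelPath (Eligible c s) L x y → Star (λ y z → y ~ z × (s′ y ≡ s′ z ⊎ z ≡ h)) x y
      lift = Star.map λ ((_ , _ , x~y , _) , e) → x~y , inj₁ (cong (λ l → if does (l Fin.≟ L h) then 1 else 0) e)

      -- Inside the class of `h`, eligible paths lead to `h`. Any other vertex walks within its
      -- class to a neighbour of the old hub, then to `c`, all on the new far side, and crosses over
      -- to `h` in the last step.
      attached′ : Attached h s′
      attached′ x with L x Fin.≟ L h | x Fin.≟ c
      ... | yes e | _ = lift (con e)
      ... | no _ | yes refl = (c~h , inj₂ refl) ◅ ε
      ... | no ne | no x≢c with spokes attached closed x x≢c
      ...   | y , Ly≡Lx , y~c = lift (con (sym Ly≡Lx)) ◅◅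
                (y~c , inj₁ (trans (s′-far λ e → ne (trans (sym Ly≡Lx) e)) (sym (s′-far Lc≢Lh)))) ◅
                (c~h , inj₂ refl) ◅ ε

      near≗cls : ∀ v → InHub s′ h v ≡ cls L (L h) v
      near≗cls v rewrite s′-near {h} refl with L v Fin.≟ L h
      ... | yes _ = refl
      ... | no  _ = refl

      light′ : LightOff h s′
      light′ = other-part-light {clsWeight w L (L h)} {Weight.subsum w (OffHub s′ h)}
        (complement (cls L (L h)) (OffHub s′ h) λ v → cong not (near≗cls v)) heavy

      -- A class lies on one side, and the far side as a whole is too light to contain a heavy one.
      h-near : s h ≡ s c
      h-near with s h ℕ.≟ s c
      ... | yes e = e
      ... | no ne = contradiction
        (ℚ.≤-trans (dbl-mono (⟨⟩-mono w≥0 {cls L (L h)} {OffHub s c} λ v e →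
           cong not (dec-false (s v ℕ.≟ s c) λ f → ne (trans (sym (side-path con (does⁻ (L v Fin.≟ L h) e))) f)))) light)
        (<⇒≱ heavy)

      -- The new near side, the class of `h`, lies within the old one and misses `c`. This is the
      -- variant that bounds the number of rounds.
      shrinks : # (InHub s′ h) ℕ.< # (InHub s c)
      shrinks = #-strict {p = InHub s′ h} {InHub s c} c
        (λ v e → dec-true (s v ℕ.≟ s c)
           (trans (side-path con (does⁻ (L v Fin.≟ L h) (trans (sym (near≗cls v)) e))) h-near))
        (trans (near≗cls c) (dec-false (L c Fin.≟ L h) Lc≢Lh))
        (dec-true (s c ℕ.≟ s c) refl)

  count-id : count {n} id ≡ n
  count-id = trans (Count.subsum-cong {n} (λ _ → 1) {live id} {λ _ → true} λ v → dec-true (v Fin.≟ v) refl) (#-full n)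

  initialise-correct : ∀ {σ} → Loaded G w σ → Run n initialise σ (λ τ → Stores τ id)
  initialise-correct {σ} loaded =
    run-fill nat LAB toℕ refl refl refl order (λ i fr x≡ → x≡) then λ fr labels →
    run-fill rat WT w refl refl refl (trans (fr nat 0 refl 0) order)
      (λ {σ′} i fr′ x≡ → trans (cong (σ′ rat 0) x≡)
        (trans (fr′ rat 0 refl (toℕ i)) (trans (fr rat 0 refl (toℕ i)) (masses i)))) then λ fr′ ws →
    run-write
      ( (λ v → trans (fr′ nat LAB refl (toℕ v)) (labels v))
      , (λ r → trans (ws r) (trans (sym (Weight.subsum-⁅⁆ w r))
          (Weight.subsum-cong w {⁅ r ⁆} {cls id r} (λ v → flip r v))))
      , trans (fr′ nat 0 refl 0) (trans (fr nat 0 refl 0) (trans order (sym count-id))) )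
    where
    open Loaded loaded
    flip : ∀ (r v : Fin n) → ⁅ r ⁆ v ≡ cls id r v
    flip r v with r Fin.≟ v
    ... | yes refl = sym (dec-true (v Fin.≟ v) refl)
    ... | no r≢v   = sym (dec-false (v Fin.≟ r) (r≢v ∘ sym))

  loaded-frame : ∀ {p σ τ} → writes p nat 0 ≡ false → writes p nat ADJ ≡ false → writes p rat 0 ≡ false →
                 Frame p σ τ → Loaded G w σ → Loaded G w τ
  loaded-frame p0 pa pw fr loaded = record
    { order  = trans (fr nat 0 p0 0) order
    ; edge   = λ u v → trans (fr nat ADJ pa _) (edge u v)
    ; masses = λ v → trans (fr rat 0 pw _) (masses v) }
    where open Loaded loaded

  components-correct : ∀ {σ c s k t} → Loaded G w σ → Setting σ c s k t → k ℕ.≤ n →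
    Run n components σ λ τ → ∃[ L ] (Stores τ L × Idempotent L × Connects (Eligible c s) L × k ℕ.≤ count L ×
                                     ∀ u v → Eligible c s u v → Settled k t L u v)
  components-correct {c = c} {s} {k} {t} loaded setting k≤n = initialise-correct loaded then λ fr st → run-conseq
    (Scan.scan-correct (record
        { order = trans (fr nat 0 refl 0) order ; edge = λ u v → trans (fr nat ADJ refl _) (edge u v)
        ; hub = trans (fr nat C refl 0) hub ; sides = λ v → trans (fr nat SIDE refl _) (sides v)
        ; quota = trans (fr nat K refl 0) quota ; limit = trans (fr rat T refl 0) limit })
      (Connects (Eligible c s)) (λ con _ (el , _) → merge-connects (Eligible c s) Eligible-sym con el)
      st (λ _ → refl) (λ { refl → ε }) (subst (k ℕ.≤_) (sym count-id) k≤n))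
    λ _ (L , st , idem , con , k≤ , settled) → L , st , idem , con , k≤ , λ u v → settled u v _
    where open Setting setting

  Sought : (Fin n → Set) → Fin n → Labelling n → Store → Set
  Sought D c L τ =
    (τ nat FLAG 0 ≡ 1 × ∀ v → D v → c ~ v → dbl (clsWeight w L (L v)) ℚ.≤ total) ⊎
    (τ nat FLAG 0 ≡ 0 × ∃[ h ] (τ nat H 0 ≡ toℕ h × c ~ h × total ℚ.< dbl (clsWeight w L (L h))))

  seek-correct : ∀ {σ c L} → Loaded G w σ → σ rat TOTAL 0 ≡ total → σ nat C 0 ≡ toℕ c → Stores σ L →
                 σ nat FLAG 0 ≡ 1 → Run n seek σ (Sought (λ _ → ⊤) c L)
  seek-correct {σ₀} {c} {L} loaded tot hub (labels , weighs , _) flag = run-conseq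
    (run-for (λ i → Sought (λ v → toℕ v ℕ.< i) c L) refl refl order id (inj₁ (flag , λ _ ()))
      λ {σ} i fr at-v inv →
        let edge′ : σ nat ADJ (σ nat C 0 ℕ.* σ nat 0 0 ℕ.+ σ nat V 0) ≡ (if does (c ~? i) then 1 else 0)
            edge′ = trans (cong₂ (λ a b → σ nat ADJ (a ℕ.+ b))
                                 (cong₂ ℕ._*_ (trans (fr nat C refl 0) hub) (trans (fr nat 0 refl 0) order)) at-v)
                          (trans (fr nat ADJ refl _) (edge c i))
            weight′ : dbl (σ rat WT (σ nat LAB (σ nat V 0))) ≡ dbl (clsWeight w L (L i))
            weight′ = cong dbl (trans (cong (σ rat WT) (trans (cong (σ nat LAB) at-v)
                        (trans (fr nat LAB refl _) (labels i)))) (trans (fr rat WT refl _) (weighs (L i))))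
            tot′ : σ rat TOTAL 0 ≡ total
            tot′ = trans (fr rat TOTAL refl 0) tot
        in run-if
          (λ (adj , ≰tot) →
            run-write {Q = λ τ → τ ≡ update nat FLAG 0 0 σ} refl then λ { _ refl →
            run-write (inj₂ (refl , i , at-v , edge⁻ edge′ adj ,
              ℚ.≰⇒> (λ ≤tot → ≰tot (subst₂ ℚ._≤_ (sym weight′) (sym tot′) ≤tot)))) })
          λ ¬h → run-skip (extend {σ} inv λ c~i → ℚ.≮⇒≥ λ heavy → ¬h (edge⁺ edge′ c~i , λ ≤tot →
            <⇒≱ heavy (subst₂ ℚ._≤_ weight′ tot′ ≤tot))))
    λ { _ (inj₁ (flag , light)) → inj₁ (flag , λ v _ → light v (Fin.toℕ<n v))
      ; _ (inj₂ found) → inj₂ found }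
    where
    open Loaded loaded
    extend : ∀ {σ} {i : Fin n} → Sought (λ v → toℕ v ℕ.< toℕ i) c L σ →
             (c ~ i → dbl (clsWeight w L (L i)) ℚ.≤ total) → Sought (λ v → toℕ v ℕ.< suc (toℕ i)) c L σ
    extend (inj₂ found) _ = inj₂ found
    extend {i = i} (inj₁ (flag , light)) lighti = inj₁ (flag , λ v v<1+i → new v (ℕ.m<1+n⇒m<n∨m≡n v<1+i))
      where
      new : ∀ v → toℕ v ℕ.< toℕ i ⊎ toℕ v ≡ toℕ i → c ~ v → dbl (clsWeight w L (L v)) ℚ.≤ total
      new v (inj₁ v<i) = light v v<i
      new v (inj₂ v≡i) with Fin.toℕ-injective v≡i
      ... | refl = lighti

  recentre-correct : ∀ {σ} {L : Labelling n} {h : Fin n} → σ nat 0 0 ≡ n →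
    (∀ v → σ nat LAB (toℕ v) ≡ toℕ (L v)) → σ nat H 0 ≡ toℕ h →
    Run n recentre σ λ τ → τ nat C 0 ≡ toℕ h ×
      ∀ v → τ nat SIDE (toℕ v) ≡ (if does (L v Fin.≟ L h) then 1 else 0)
  recentre-correct {σ₀} {L} {h} order labels at-h =
    run-map nat SIDE (λ v → if does (L v Fin.≟ L h) then 1 else 0) (λ v → σ₀ nat SIDE (toℕ v))
      refl refl refl order (λ _ → refl)
      (λ {σ} i fr x≡ _ →
        let lab-x : σ nat LAB (σ nat X 0) ≡ toℕ (L i)
            lab-x = trans (cong (σ nat LAB) x≡) (trans (fr nat LAB refl _) (labels i))
            lab-h : σ nat LAB (σ nat H 0) ≡ toℕ (L h)
            lab-h = trans (cong (σ nat LAB) (trans (fr nat H refl 0) at-h)) (trans (fr nat LAB refl _) (labels h))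
        in run-if
          (λ eq → run-write
            ( update-at nat SIDE σ x≡ (λ _ → sym (cong bit (dec-true (L i Fin.≟ L h)
                (Fin.toℕ-injective (trans (sym lab-x) (trans (≐⁻ eq) lab-h)))))) (contradiction refl)
            , λ v i≢v → update-at nat SIDE σ x≡ (λ i≡v → contradiction i≡v i≢v) (λ _ → refl) ))
          (λ ne → run-write
            ( update-at nat SIDE σ x≡ (λ _ → sym (cong bit (dec-false (L i Fin.≟ L h)
                λ e → ne (≐⁺ (trans lab-x (trans (cong toℕ e) (sym lab-h))))))) (contradiction refl)
            , λ v i≢v → update-at nat SIDE σ x≡ (λ i≡v → contradiction i≡v i≢v) (λ _ → refl) )))
    then λ fr sides → run-write (trans (fr nat H refl 0) at-h , sides)

  -- The light spokes of a centre are witnessed by the components found in the last round.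
  Centre : Fin n → (Fin n → ℕ) → Set
  Centre c s = Attached c s × ∃[ L ] (Closed (Eligible c s) L × LightSpokes c L)

  Descending : ℕ → Store → Set
  Descending m σ = ∃[ c ] ∃[ s ] (σ nat C 0 ≡ toℕ c × (∀ v → σ nat SIDE (toℕ v) ≡ s v) ×
    ((σ nat FLAG 0 ≡ 0 × Attached c s × LightOff c s × # (InHub s c) ℕ.≤ m) ⊎
     (σ nat FLAG 0 ≡ 1 × Centre c s)))

  Centred : Store → Set
  Centred σ = ∃[ c ] ∃[ s ] (σ nat C 0 ≡ toℕ c × (∀ v → σ nat SIDE (toℕ v) ≡ s v) × Centre c s)

  descend-correct : ∀ {σ} → Loaded G w σ → σ rat TOTAL 0 ≡ total → σ rat T 0 ≡ dbl total → σ nat K 0 ≡ 0 →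
                    Descending n σ → Run n descend σ Centred
  descend-correct {σ₀} loaded tot lim quota₀ start = run-conseq
    (run-while Descending start (λ {σ} → stop {σ}) (λ {m} {σ} → body {m} {σ}))
    λ { _ (≢0 , m , c , s , _ , _ , inj₁ (flag , _)) → contradiction (≐⁺ flag) ≢0
      ; _ (_ , m , c , s , hub , sides , inj₂ (_ , centre)) → c , s , hub , sides , centre }
    where
    stop : ∀ {σ} → Descending 0 σ → ¬ (σ nat FLAG 0 ℕ.≤ 0 × 0 ℕ.≤ σ nat FLAG 0)
    stop (c , s , _ , _ , inj₁ (_ , _ , _ , none)) _ =
      contradiction (#-positive {p = InHub s c} c (dec-true (s c ℕ.≟ s c) refl)) (ℕ.≤⇒≯ none)
    stop (_ , _ , _ , _ , inj₂ (flag , _)) h = contradiction (trans (sym flag) (≐⁻ h)) λ ()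

    body : ∀ {m σ} → _ → (σ nat FLAG 0 ℕ.≤ 0 × 0 ℕ.≤ σ nat FLAG 0) → Descending (suc m) σ → Run n round σ (Descending m)
    body _ h (_ , _ , _ , _ , inj₂ (flag , _)) = contradiction (trans (sym flag) (≐⁻ h)) λ ()
    body {m} {σ} fr _ (c , s , hub , sides , inj₁ (flag , attached , light , few)) =
      components-correct loaded₁ setting z≤n then λ { {τ₁} fr₁ (L , (labels , weighs , cnt) , idem , con , _ , settled) →
      run-write {Q = λ τ → τ ≡ update nat FLAG 0 1 τ₁} refl then λ { fr′ refl →
      seek-correct {L = L} (loaded-frame {write nat FLAG (lit 0) (lit 1)} refl refl refl fr′
                             (loaded-frame {components} refl refl refl fr₁ loaded₁))
        (trans (fr₁ rat TOTAL refl 0) (trans (fr rat TOTAL refl 0) tot))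
        (trans (fr₁ nat C refl 0) hub) (labels , weighs , cnt) refl then λ {τ₂} fr₂ found →
      -- During the search the quota is 0 and never binds, so the classes are entire components.
      let closed : Closed (Eligible c s) L
          closed = settled-closed {L = L} (count-positive {L} idem c) settled
          hub₂ : τ₂ nat C 0 ≡ toℕ c
          hub₂ = trans (fr₂ nat C refl 0) (trans (fr₁ nat C refl 0) hub)
          sides₂ : ∀ v → τ₂ nat SIDE (toℕ v) ≡ s v
          sides₂ v = trans (fr₂ nat SIDE refl _) (trans (fr₁ nat SIDE refl _) (sides v))
      in run-if
        (λ h → again {τ₂} (trans (fr₂ nat 0 refl 0) (trans (fr₁ nat 0 refl 0) (Loaded.order loaded₁)))
                     (λ v → trans (fr₂ nat LAB refl _) (labels v)) con closed h found)
        (λ ¬h → run-skip (c , s , hub₂ , sides₂ , done τ₂ closed ¬h found)) } }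
      where
      loaded₁ : Loaded G w σ
      loaded₁ = loaded-frame {round} refl refl refl fr loaded
      setting : Setting σ c s 0 (dbl total)
      setting = record
        { order = Loaded.order loaded₁ ; edge = Loaded.edge loaded₁ ; hub = hub ; sides = sides
        ; quota = trans (fr nat K refl 0) quota₀ ; limit = trans (fr rat T refl 0) lim }

      again : ∀ {τ} {L : Labelling n} → τ nat 0 0 ≡ n → (∀ v → τ nat LAB (toℕ v) ≡ toℕ (L v)) →
              Connects (Eligible c s) L → Closed (Eligible c s) L → (τ nat FLAG 0 ℕ.≤ 0 × 0 ℕ.≤ τ nat FLAG 0) →
              Sought (λ _ → ⊤) c L τ → Run n recentre τ (Descending m)
      again _ _ _ _ h (inj₁ (flag , _)) = contradiction (trans (sym flag) (≐⁻ h)) λ ()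
      again {L = L} order labels con closed _ (inj₂ (flag , h , at-h , c~h , heavy)) = run-conseq
        (recentre-correct {L = L} order labels at-h)
        λ fr (hub , sides) → h , s′ , hub , sides ,
          inj₁ (trans (fr nat FLAG refl 0) flag , attached′ , light′ , ℕ.s≤s⁻¹ (ℕ.≤-trans shrinks few))
        where open Recentring {L = L} attached light con closed c~h heavy

      done : ∀ τ {L} → Closed (Eligible c s) L → ¬ (τ nat FLAG 0 ℕ.≤ 0 × 0 ℕ.≤ τ nat FLAG 0) →
             Sought (λ _ → ⊤) c L τ →
             (τ nat FLAG 0 ≡ 0 × Attached c s × LightOff c s × # (InHub s c) ℕ.≤ m) ⊎ (τ nat FLAG 0 ≡ 1 × Centre c s)
      done _ _ ¬h (inj₂ (flag , _)) = contradiction (≐⁺ flag) ¬h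
      done _ {L} closed _ (inj₁ (flag , lightN)) = inj₂ (flag , attached , L , closed , λ x x≢c →
        let y , Ly≡Lx , y~c = spokes attached closed x x≢c
        in subst (λ l → dbl (clsWeight w L l) ℚ.≤ total) Ly≡Lx (lightN y _ (~-sym y~c)))

-- Reduction to k classes

-- The components are built anew under the quota, because the unrestricted ones of the search may
-- number fewer than `k`. Clearing `SIDE` then admits the edges between the two sides, and lowering
-- `T` from twice the total to the total imposes the cap.
balance : ℕ → Program
balance k = write nat K (lit 0) (lit k) ⨾ components ⨾ forᵖ X (write nat SIDE (var X) (lit 0)) ⨾
            write rat T (lit 0) (read rat TOTAL (lit 0)) ⨾ scan

lightest absorbLightest condense : Program
lightest = forᵖ V (ifᵖ (lab (var V) ≐ var V) ∧ᶜ notᶜ (var V ≐ var C)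
                   then (ifᵖ (var B ≐ var C) then write nat B (lit 0) (var V)
                         else (ifᵖ wt (var V) ≤ᶜ wt (var B) then write nat B (lit 0) (var V) else skip))
                   else skip)
absorbLightest = write nat A (lit 0) (var C) ⨾ write nat B (lit 0) (var C) ⨾ lightest ⨾ absorb
condense = while ((var K ⊕ lit 1) ≤ᶜ var CNT) loop absorbLightest

module Balancing {n : ℕ} {{n≢0 : NonZero n}} (G : Graph n) {w : Fin n → ℚ} (w≥0 : ∀ v → 0ℚ ℚ.≤ w v) where
  open Graph G
  open Descent G w≥0 public

  record Wheel (k : ℕ) (c : Fin n) (L : Labelling n) : Set where
    field
      connects : Connects _~_ L
      alone    : HubAlone c L
      light    : LightSpokes c L
      -- A phase stopped by the quota may leave classes that miss the hub, but then there is nothing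
      -- to absorb.
      attached : count L ℕ.≤ k ⊎ Spokes c L

  -- Even if the quota has stopped the merging early, each class lies within a component `L₁` of the
  -- last search round and inherits its lightness.
  components-wheel : ∀ {k c s L} → Centre c s → Connects (Eligible c s) L →
                     (∀ u v → Eligible c s u v → Settled k (dbl total) L u v) → Wheel k c L
  components-wheel {k} {c} {s} {L} (attached , L₁ , closed₁ , light₁) con settled = record
    { connects = Star.map (λ ((_ , _ , u~v , _) , e) → u~v , e) ∘ con
    ; alone = hub-alone con
    ; light = λ x x≢c → ℚ.≤-trans (dbl-mono (⟨⟩-mono w≥0 {cls L (L x)} {cls L₁ (L₁ x)} λ v e →
        dec-true (L₁ v Fin.≟ L₁ x) (coarser (con (does⁻ (L v Fin.≟ L x) e))))) (light₁ x x≢c)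
    ; attached = done }
    where
    coarser : ∀ {u v} → LabelPath (Eligible c s) L u v → L₁ u ≡ L₁ v
    coarser ε = refl
    coarser ((el , _) ◅ path) = trans (closed₁ el) (coarser path)
    done : count L ℕ.≤ k ⊎ Spokes c L
    done with count L ℕ.≤? k
    ... | yes c≤k = inj₁ c≤k
    ... | no c≰k = inj₂ (spokes attached (settled-closed {L = L} (ℕ.≰⇒> c≰k) settled))

  wheel-merge : ∀ {k c L u v} → u ≢ c → v ≢ c → u ~ v → L u ≢ L v → k ℕ.< count L →
                pairWeight L u v ℚ.≤ total → Wheel k c L → Wheel k c (merge L (L u) (L v))
  wheel-merge {k} {c} {L} {u} {v} u≢c v≢c u~v l≢ k< pair≤ wheel = record
    { connects = merge-connects _~_ ~-sym connects u~v
    ; alone = alone′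
    ; light = light′
    ; attached = spokes′ attached }
    where
    open Wheel wheel
    alone′ : HubAlone c (merge L (L u) (L v))
    alone′ x e with merge-cases {L = L} {L u} {L v} x c e
    ... | inj₁ e′ = alone x e′
    ... | inj₂ (inj₁ (_ , Lc≡Lu)) = contradiction (alone u (sym Lc≡Lu)) u≢c
    ... | inj₂ (inj₂ (_ , Lc≡Lv)) = contradiction (alone v (sym Lc≡Lv)) v≢c
    both : dbl (clsWeight w (merge L (L u) (L v)) (L u)) ℚ.≤ total
    both = subst (λ z → dbl z ℚ.≤ total) (sym (clsWeight-kept w {L} l≢)) pair≤
    light′ : LightSpokes c (merge L (L u) (L v))
    light′ x x≢c with L x Fin.≟ L v
    ... | yes _ = both
    ... | no Lx≢Lv with L x Fin.≟ L u
    ...   | yes Lx≡Lu = subst (λ l → dbl (clsWeight w (merge L (L u) (L v)) l) ℚ.≤ total) (sym Lx≡Lu) both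
    ...   | no  Lx≢Lu = subst (λ z → dbl z ℚ.≤ total)
                          (sym (clsWeight-untouched w {L} l≢ Lx≢Lu Lx≢Lv)) (light x x≢c)
    spokes′ : count L ℕ.≤ k ⊎ Spokes c L → count (merge L (L u) (L v)) ℕ.≤ k ⊎ Spokes c (merge L (L u) (L v))
    spokes′ (inj₁ c≤k) = contradiction k< (ℕ.≤⇒≯ c≤k)
    spokes′ (inj₂ sp) = inj₂ λ x x≢c → let y , Ly≡Lx , y~c = sp x x≢c in y , merge-cong {L = L} Ly≡Lx , y~c

  Stuck : ℕ → Fin n → Labelling n → Set
  Stuck k c L = ∀ {u v} → u ≢ c → v ≢ c → u ~ v → Settled k total L u v

  Balanced : ℕ → Store → Set
  Balanced k σ = ∃[ c ] ∃[ L ] (σ nat C 0 ≡ toℕ c × σ nat K 0 ≡ k × Stores σ L × Idempotent L ×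
                                k ℕ.≤ count L × Wheel k c L × Stuck k c L)

  balance-correct : ∀ {σ k} → Loaded G w σ → σ rat TOTAL 0 ≡ total → σ rat T 0 ≡ dbl total → k ℕ.≤ n →
                    Centred σ → Run n (balance k) σ (Balanced k)
  balance-correct {σ} {k} loaded tot lim k≤n (c , s , hub , sides , centre) =
    run-write {Q = λ τ → τ ≡ σ₁} refl then λ { fr₁ refl →
    components-correct {k = k} (loaded-frame {write nat K (lit 0) (lit k)} refl refl refl fr₁ loaded)
      (record { order = order ; edge = edge ; hub = hub ; sides = sides ; quota = refl ; limit = lim }) k≤n
    then λ { {τ₂} fr₂ (L , (labels , weighs , cnt) , idem , con , k≤ , settled) →
    run-fill nat SIDE (λ _ → 0) refl refl refl (trans (fr₂ nat 0 refl 0) order) (λ _ _ _ → refl)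
    then λ {τ₃} fr₃ sides₃ →
    run-write {Q = λ τ → τ ≡ update rat T 0 (τ₃ rat TOTAL 0) τ₃} refl then λ { _ refl →
    let hub₃ = trans (fr₃ nat C refl 0) (trans (fr₂ nat C refl 0) hub)
        quota₃ = trans (fr₃ nat K refl 0) (fr₂ nat K refl 0) in
    run-conseq
      (Scan.scan-correct {s = λ _ → 0}
        (record
          { order = trans (fr₃ nat 0 refl 0) (trans (fr₂ nat 0 refl 0) order)
          ; edge = λ u v → trans (fr₃ nat ADJ refl _) (trans (fr₂ nat ADJ refl _) (edge u v))
          ; hub = hub₃ ; sides = sides₃ ; quota = quota₃
          ; limit = trans (fr₃ rat TOTAL refl 0) (trans (fr₂ rat TOTAL refl 0) tot) })
        (Wheel k c)
        (λ {L} wheel _ ((u≢c , v≢c , u~v , _) , l≢ , k< , pair≤) → wheel-merge {L = L} u≢c v≢c u~v l≢ k< pair≤ wheel)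
        {L}
        ( (λ v → trans (fr₃ nat LAB refl _) (labels v)) , (λ r → trans (fr₃ rat WT refl _) (weighs r))
        , trans (fr₃ nat CNT refl 0) cnt)
        idem (components-wheel centre con settled) k≤)
      λ fr₄ (L′ , st , idem′ , wheel , k≤′ , settled′) →
        c , L′ , trans (fr₄ nat C refl 0) hub₃ , trans (fr₄ nat K refl 0) quota₃ , st , idem′ , k≤′ , wheel ,
        λ {u} {v} u≢c v≢c u~v → settled′ u v _ (u≢c , v≢c , u~v , refl) } } }
    where
    open Loaded loaded
    σ₁ : Store
    σ₁ = update nat K 0 k σ

  module Condensing {k : ℕ} {c : Fin n} {L₀ : Labelling n} where

    -- `S` is a set of labels of `L₀`, later those met by the classes of a competitor. It will
    -- always contain the label `c`, so the hub is taken out separately.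
    Touching : Pred n → Pred n
    Touching S v = S (L₀ v) ∧ not (⁅ c ⁆ v)

    Outside : Labelling n → Pred n
    Outside L v = not (cls L c v)

    record Condensed (L : Labelling n) : Set where
      field
        connects : Connects _~_ L
        hub-self : L c ≡ c
        light    : ∀ x → L x ≢ c → dbl (clsWeight w L (L x)) ℚ.≤ total
        refines  : ∀ v → L v ≡ L₀ v ⊎ L v ≡ c
        -- Either nothing has been absorbed, or `L₀` has more than `k` classes; in the second case
        -- the quota has not stopped the balancing, and all classes touch the hub.
        progress : (∀ v → L v ≡ L₀ v) ⊎ k ℕ.< count L₀
        shrunk   : count L ℕ.≤ count L₀
        attached : k ℕ.< count L₀ → ∀ x → L x ≢ c → ∃[ y ] (L y ≡ L x × y ~ c)
        -- The classes left outside the hub are the heaviest possible.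
        greedy   : ∀ S → S c ≡ true → # S ℕ.≤ count L →
                   Weight.subsum w (Touching S) ℚ.≤ Weight.subsum w (Outside L)

    condensed-start : Idempotent L₀ → Wheel k c L₀ → Condensed L₀
    condensed-start idem wheel = record
      { connects = connects ; hub-self = L₀c≡c
      ; light = λ x Lx≢c → light x λ { refl → Lx≢c L₀c≡c }
      ; refines = λ _ → inj₁ refl ; progress = inj₁ λ _ → refl ; shrunk = ℕ.≤-refl
      ; attached = spokes′ attached
      ; greedy = λ S _ _ → ⟨⟩-mono w≥0 {Touching S} {Outside L₀} (outside S) }
      where
      open Wheel wheel
      L₀c≡c : L₀ c ≡ c
      L₀c≡c = alone (L₀ c) (idem c)
      spokes′ : count L₀ ℕ.≤ k ⊎ Spokes c L₀ → k ℕ.< count L₀ → ∀ x → L₀ x ≢ c → ∃[ y ] (L₀ y ≡ L₀ x × y ~ c)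
      spokes′ (inj₁ c≤k) k< = contradiction k< (ℕ.≤⇒≯ c≤k)
      spokes′ (inj₂ sp) _ x Lx≢c = sp x λ { refl → Lx≢c L₀c≡c }
      outside : ∀ S v → Touching S v ≡ true → Outside L₀ v ≡ true
      outside S v e with L₀ v Fin.≟ c
      ... | no  _    = refl
      ... | yes L₀v≡c rewrite alone v (trans L₀v≡c (sym L₀c≡c)) | dec-true (c Fin.≟ c) refl =
        contradiction (trans (sym (Bool.∧-zeroʳ (S (L₀ c)))) e) λ ()

    condensed-step : ∀ {L b} → Idempotent L → L b ≡ b → b ≢ c → k ℕ.< count L →
                     (∀ r → L r ≡ r → r ≢ c → clsWeight w L b ℚ.≤ clsWeight w L r) →
                     Condensed L → Condensed (merge L c b)
    condensed-step {L} {b} idem Lb≡b b≢c k< least cond = record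
      { connects = connects′
      ; hub-self = trans (merge-miss {L = L} {c} {b} Lc≢b) hub-self
      ; light = light′
      ; refines = refines′
      ; progress = inj₂ k<₀
      ; shrunk = ℕ.≤-trans (ℕ.n≤1+n _) (subst (ℕ._≤ count L₀) count≡ shrunk)
      ; attached = λ _ x L′x≢c → let y , Ly≡Lx , y~c = attached k<₀ x (proj₁ (outer x L′x≢c))
                                 in y , merge-cong {L = L} Ly≡Lx , y~c
      ; greedy = greedy′ }
      where
      open Condensed cond
      L′ : Labelling n
      L′ = merge L c b
      Lc≢b : L c ≢ b
      Lc≢b e = b≢c (trans (sym e) hub-self)
      c≢b : c ≢ b
      c≢b e = b≢c (sym e)
      count≡ : count L ≡ suc (count L′)
      count≡ = count-merge {L = L} idem hub-self Lb≡b c≢b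
      k<₀ : k ℕ.< count L₀
      k<₀ = ℕ.<-≤-trans k< shrunk

      -- The absorbed class contains a neighbour `y` of the hub, and the edge from the hub to `y`
      -- joins the two connected classes.
      connects′ : Connects _~_ L′
      connects′ with attached k<₀ b (λ e → b≢c (trans (sym Lb≡b) e))
      ... | y , Ly≡Lb , y~c = subst₂ (λ a b → Connects _~_ (merge L a b)) hub-self (trans Ly≡Lb Lb≡b)
                                (merge-connects _~_ ~-sym connects (~-sym y~c))

      outer : ∀ x → L′ x ≢ c → L x ≢ c × L x ≢ b
      outer x L′x≢c with L x Fin.≟ b
      ... | yes _   = contradiction refl L′x≢c
      ... | no Lx≢b = L′x≢c , Lx≢b

      light′ : ∀ x → L′ x ≢ c → dbl (clsWeight w L′ (L′ x)) ℚ.≤ total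
      light′ x L′x≢c with outer x L′x≢c
      ... | Lx≢c , Lx≢b rewrite merge-miss {L = L} {c} {b} Lx≢b =
        subst (λ z → dbl z ℚ.≤ total) (sym (clsWeight-untouched w {L} c≢b Lx≢c Lx≢b)) (light x Lx≢c)

      refines′ : ∀ v → L′ v ≡ L₀ v ⊎ L′ v ≡ c
      refines′ v with L v Fin.≟ b
      ... | yes _ = inj₂ refl
      ... | no  _ = refines v

      outside-split : Weight.subsum w (Outside L) ≡ Weight.subsum w (Outside L′) ℚ.+ clsWeight w L b
      outside-split = Weight.subsum-⊎ w {Outside L′} {cls L b} {Outside L} cell disjoint
        where
        cell : ∀ v → Outside L v ≡ Outside L′ v ∨ cls L b v
        cell v with L v Fin.≟ b
        ... | yes Lv≡b rewrite dec-false (L v Fin.≟ c) (λ e → b≢c (trans (sym Lv≡b) e)) = sym (Bool.∨-zeroʳ _)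
        ... | no _ = sym (Bool.∨-identityʳ _)
        disjoint : ∀ v → Outside L′ v ≡ true → cls L b v ≡ false
        disjoint v e with L v Fin.≟ b
        ... | no _ = refl
        ... | yes _ rewrite dec-true (c Fin.≟ c) refl = contradiction e λ ()

      -- An exchange argument: `S` misses some live label `t`, and `S` with `t` added is small
      -- enough for `L`. So `S` and the class of `t` together weigh at most what lies outside the
      -- hub's class in `L`, and passing to `L′` removes from there the class of `b`, which is no
      -- heavier than that of `t`.
      greedy′ : ∀ S → S c ≡ true → # S ℕ.≤ count L′ →
                Weight.subsum w (Touching S) ℚ.≤ Weight.subsum w (Outside L′)
      greedy′ S Sc #S with pigeonhole {p = S} {live L} (subst (# S ℕ.<_) (sym count≡) (s≤s #S))
      ... | t , live-t , St≡false = ℚ.≮⇒≥ λ out<in → ℚ.<-irrefl refl (begin-strict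
        Weight.subsum w (Outside L′) ℚ.+ clsWeight w L b   <⟨ ℚ.+-mono-<-≤ out<in (least t Lt≡t t≢c) ⟩
        Weight.subsum w (Touching S) ℚ.+ clsWeight w L t
          ≡⟨ Weight.subsum-⊎ w {Touching S} {cls L t} {λ v → Touching S v ∨ cls L t v} (λ _ → refl) disjoint ⟨
        Weight.subsum w (λ v → Touching S v ∨ cls L t v)
          ≤⟨ ⟨⟩-mono w≥0 {λ v → Touching S v ∨ cls L t v} {Touching S⁺} incl ⟩
        Weight.subsum w (Touching S⁺)                      ≤⟨ greedy S⁺ S⁺c #S⁺ ⟩
        Weight.subsum w (Outside L)                        ≡⟨ outside-split ⟩
        Weight.subsum w (Outside L′) ℚ.+ clsWeight w L b   ∎)
        where
        open ℚ.≤-Reasoning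
        Lt≡t : L t ≡ t
        Lt≡t = live⁻ {L = L} live-t
        t≢c : t ≢ c
        t≢c refl = contradiction (trans (sym Sc) St≡false) λ ()
        S⁺ : Pred n
        S⁺ v = ⁅ t ⁆ v ∨ S v
        S⁺c : S⁺ c ≡ true
        S⁺c rewrite Sc = Bool.∨-zeroʳ (⁅ t ⁆ c)
        #S⁺ : # S⁺ ℕ.≤ count L
        #S⁺ = subst (# S⁺ ℕ.≤_) (sym count≡) (ℕ.≤-trans (#-insert-≤ {p = S} {S⁺} t λ _ → refl) (s≤s #S))
        origin : ∀ v → L v ≡ t → L₀ v ≡ t
        origin v Lv≡t with refines v
        ... | inj₁ e = trans (sym e) Lv≡t
        ... | inj₂ e = contradiction (trans (sym Lv≡t) e) t≢c
        disjoint : ∀ v → Touching S v ≡ true → cls L t v ≡ false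
        disjoint v e with L v Fin.≟ t
        ... | no _ = refl
        ... | yes Lv≡t rewrite origin v Lv≡t | St≡false = contradiction e λ ()
        incl : ∀ v → (Touching S v ∨ cls L t v) ≡ true → Touching S⁺ v ≡ true
        incl v e with L v Fin.≟ t
        ... | yes Lv≡t rewrite origin v Lv≡t | dec-true (t Fin.≟ t) refl =
          cong not (dec-false (c Fin.≟ v) λ { refl → t≢c (trans (sym Lv≡t) hub-self) })
        ... | no _ with S (L₀ v)
        ...   | false = contradiction e λ ()
        ...   | true rewrite Bool.∨-zeroʳ (⁅ t ⁆ (L₀ v)) = trans (sym (Bool.∨-identityʳ _)) e

    -- As long as no class off the hub has been met, `B` holds the hub as a sentinel. Hence `b ≢ c`
    -- is asserted only in the presence of a candidate `r`.
    Lightest : (Fin n → Set) → Labelling n → Store → Set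
    Lightest D L σ = ∃[ b ] (σ nat B 0 ≡ toℕ b × L b ≡ b ×
                             ∀ r → D r → L r ≡ r → r ≢ c → b ≢ c × clsWeight w L b ℚ.≤ clsWeight w L r)

    lightest-correct : ∀ {σ L} → σ nat 0 0 ≡ n → σ nat C 0 ≡ toℕ c → σ nat B 0 ≡ toℕ c → Stores σ L → L c ≡ c →
                       Run n lightest σ (Lightest (λ _ → ⊤) L)
    lightest-correct {σ₀} {L} order hub best (labels , weighs , _) Lc≡c = run-conseq
      (run-for (λ i → Lightest (λ r → toℕ r ℕ.< i) L) refl refl order id (c , best , Lc≡c , λ _ ())
        λ { {σ} i fr at-v (b , at-b , Lb≡b , least) →
          let hub′ : σ nat C 0 ≡ toℕ c
              hub′ = trans (fr nat C refl 0) hub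
              lab′ : σ nat LAB (σ nat V 0) ≡ toℕ (L i)
              lab′ = trans (cong (σ nat LAB) at-v) (trans (fr nat LAB refl _) (labels i))
              wt-v : σ rat WT (σ nat V 0) ≡ clsWeight w L i
              wt-v = trans (cong (σ rat WT) at-v) (trans (fr rat WT refl _) (weighs i))
              wt-b : σ rat WT (σ nat B 0) ≡ clsWeight w L b
              wt-b = trans (cong (σ rat WT) at-b) (trans (fr rat WT refl _) (weighs b))
          in run-if
            (λ (lv , v≢) →
              let Li≡i : L i ≡ i
                  Li≡i = Fin.toℕ-injective (trans (sym lab′) (trans (≐⁻ lv) at-v))
                  i≢c : i ≢ c
                  i≢c e = v≢ (≐⁺ (trans at-v (trans (cong toℕ e) (sym hub′))))
              in run-if
                (λ b≐c → run-write (i , at-v , Li≡i , extend i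
                  (λ r r<i Lr r≢c → contradiction (Fin.toℕ-injective (trans (sym at-b) (trans (≐⁻ b≐c) hub′)))
                                                  (proj₁ (least r r<i Lr r≢c)))
                  (λ _ _ → i≢c , ℚ.≤-refl)))
                (λ b≢ → run-if
                  (λ wi≤ → run-write (i , at-v , Li≡i , extend i
                    (λ r r<i Lr r≢c → i≢c , ℚ.≤-trans (subst₂ ℚ._≤_ wt-v wt-b wi≤) (proj₂ (least r r<i Lr r≢c)))
                    (λ _ _ → i≢c , ℚ.≤-refl)))
                  (λ wi≰ → run-skip (b , at-b , Lb≡b , extend i least
                    (λ _ _ → (λ e → b≢ (≐⁺ (trans at-b (trans (cong toℕ e) (sym hub′)))))
                           , ℚ.<⇒≤ (subst₂ ℚ._<_ wt-b wt-v (ℚ.≰⇒> wi≰)))))))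
            (λ ¬h → run-skip (b , at-b , Lb≡b , extend i least
              (λ Li≡i i≢c → contradiction
                ( ≐⁺ (trans lab′ (trans (cong toℕ Li≡i) (sym at-v)))
                , λ v≐c → i≢c (Fin.toℕ-injective (trans (sym at-v) (trans (≐⁻ v≐c) hub′))) ) ¬h))) })
      λ { _ (b , at-b , Lb≡b , least) → b , at-b , Lb≡b , λ r _ → least r (Fin.toℕ<n r) }
      where
      extend : ∀ (i : Fin n) {Y : Fin n → Set} →
               (∀ r → toℕ r ℕ.< toℕ i → L r ≡ r → r ≢ c → Y r) → (L i ≡ i → i ≢ c → Y i) →
               ∀ r → toℕ r ℕ.< suc (toℕ i) → L r ≡ r → r ≢ c → Y r
      extend i old new r r< with ℕ.m<1+n⇒m<n∨m≡n r<
      ... | inj₁ r<i = old r r<i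
      ... | inj₂ r≡i with Fin.toℕ-injective r≡i
      ...   | refl = new

    CondensedStore : ℕ → Store → Set
    CondensedStore m σ = ∃[ L ] (Stores σ L × Idempotent L × k ℕ.≤ count L × count L ℕ.≤ m × Condensed L)

    condense-correct : ∀ {σ} → σ nat 0 0 ≡ n → σ nat C 0 ≡ toℕ c → σ nat K 0 ≡ k → 0 ℕ.< k →
                       CondensedStore n σ →
                       Run n condense σ λ τ → ∃[ L ] (Stores τ L × Idempotent L × count L ≡ k × Condensed L)
    condense-correct {σ₀} order hub quota 0<k start = run-conseq
      (run-while CondensedStore start (λ {σ} → stop {σ}) (λ {m} {σ} → body {m} {σ}))
      λ { fr (¬more , m , L , st , idem , k≤ , _ , cond) → L , st , idem ,
          ℕ.≤-antisym (ℕ.≮⇒≥ λ k< → ¬more (subst₂ ℕ._≤_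
            (trans (ℕ.+-comm 1 k) (cong (ℕ._+ 1) (sym (trans (fr nat K refl 0) quota)))) (sym (proj₂ (proj₂ st))) k<)) k≤ ,
          cond }
      where
      more : Store → Set
      more σ = σ nat K 0 ℕ.+ 1 ℕ.≤ σ nat CNT 0

      stop : ∀ {σ} → CondensedStore 0 σ → ¬ more σ
      stop {σ} (L , (_ , _ , cnt) , _ , _ , none , _) h = ℕ.1+n≰n {0}
        (ℕ.≤-trans (ℕ.m≤n+m 1 (σ nat K 0)) (ℕ.≤-trans h (ℕ.≤-trans (ℕ.≤-reflexive cnt) none)))

      body : ∀ {m σ} → Frame absorbLightest σ₀ σ → more σ → CondensedStore (suc m) σ →
             Run n absorbLightest σ (CondensedStore m)
      body {m} {σ} fr h (L , (labels , weighs , cnt) , idem , k≤ , ≤m , cond) =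
        run-write {Q = λ τ → τ ≡ σ₁} refl then λ { _ refl →
        run-write {Q = λ τ → τ ≡ σ₂} refl then λ { _ refl →
        lightest-correct {L = L} order′ hub′ hub′ (labels , weighs , cnt) hub-self
        then λ fr₃ (b , at-b , Lb≡b , least) →
        let b≢c : b ≢ c
            b≢c = proj₁ (least _ _ (live⁻ {L = L} (proj₁ (proj₂ other))) other≢c)
            cnt≡ = count-merge {L = L} {c} {b} idem hub-self Lb≡b (b≢c ∘ sym)
        in run-conseq
          (absorb-correct {L = L} (trans (fr₃ nat 0 refl 0) order′) (trans (fr₃ nat A refl 0) hub′) at-b
            ( (λ v → trans (fr₃ nat LAB refl _) (labels v)) , (λ r → trans (fr₃ rat WT refl _) (weighs r))
            , trans (fr₃ nat CNT refl 0) cnt)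
            idem hub-self Lb≡b (b≢c ∘ sym))
          λ _ st → merge L c b , st , merge-idempotent {L = L} idem hub-self (b≢c ∘ sym) ,
            ℕ.s≤s⁻¹ (subst (suc k ℕ.≤_) cnt≡ k<) , ℕ.s≤s⁻¹ (subst (ℕ._≤ suc m) cnt≡ ≤m) ,
            condensed-step {L} idem Lb≡b b≢c k< (λ r Lr r≢c → proj₂ (least r _ Lr r≢c)) cond } }
        where
        open Condensed cond
        σ₁ σ₂ : Store
        σ₁ = update nat A 0 (σ nat C 0) σ
        σ₂ = update nat B 0 (σ nat C 0) σ₁
        order′ : σ nat 0 0 ≡ n
        order′ = trans (fr nat 0 refl 0) order
        hub′ : σ nat C 0 ≡ toℕ c
        hub′ = trans (fr nat C refl 0) hub
        k< : k ℕ.< count L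
        k< = subst₂ ℕ._≤_ (trans (cong (ℕ._+ 1) (trans (fr nat K refl 0) quota)) (ℕ.+-comm k 1)) cnt h
        -- As `k` is positive, at least two classes are left; one off the hub exists, and `B` cannot
        -- end with its sentinel value.
        other : ∃[ v ] (live L v ≡ true × ⁅ c ⁆ v ≡ false)
        other = pigeonhole {p = ⁅ c ⁆} {live L}
          (subst (ℕ._< count L) (sym (Count.subsum-⁅⁆ (λ _ → 1) c)) (ℕ.≤-<-trans 0<k k<))
        other≢c : proj₁ other ≢ c
        other≢c e = does⁻¬ (c Fin.≟ proj₁ other) (proj₂ (proj₂ other)) (sym e)

-- Summation, output and rational arithmetic

tally emit : Program
tally = forᵖ X (write rat TOTAL (lit 0) (read rat TOTAL (lit 0) ⊕ read rat 0 (var X))) ⨾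
        write rat T (lit 0) (read rat TOTAL (lit 0) ⊕ read rat TOTAL (lit 0))
-- All representatives are numbered before any class number is written, since a vertex may precede
-- its representative.
emit  = write nat H (lit 0) (lit 0) ⨾
        forᵖ V (write nat RANK (var V) (var H) ⨾
                ifᵖ (lab (var V) ≐ var V) then write nat H (lit 0) (var H ⊕ lit 1) else skip) ⨾
        forᵖ X (write nat OUT (var X) (read nat RANK (lab (var X))))

module Framing {n : ℕ} {{n≢0 : NonZero n}} (G : Graph n) {w : Fin n → ℚ} (w≥0 : ∀ v → 0ℚ ℚ.≤ w v) where
  open Balancing G w≥0 public

  tally-correct : ∀ {σ} → Loaded G w σ → σ rat TOTAL 0 ≡ 0ℚ →
                  Run n tally σ λ τ → τ rat TOTAL 0 ≡ total × τ rat T 0 ≡ dbl total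
  tally-correct {σ₀} loaded zeroed =
    run-for (λ i σ → σ rat TOTAL 0 ≡ Weight.subsum w (below (λ _ → true) i)) refl refl order id
      (trans zeroed (sym (Weight.subsum-∅ w {below (λ _ → true) 0} λ _ → refl)))
      (λ {σ} i fr x≡ sofar → run-write (trans
        (cong₂ ℚ._+_ sofar (trans (cong (σ rat 0) x≡) (trans (fr rat 0 refl _) (masses i))))
        (trans (ℚ.+-comm _ (w i)) (sym (trans
          (Weight.subsum-⊎ w {⁅ i ⁆} {below (λ _ → true) (toℕ i)} {below (λ _ → true) (suc (toℕ i))}
            (λ v → below-suc (λ _ → true) i v refl) (disjoint i))
          (cong (ℚ._+ Weight.subsum w (below (λ _ → true) (toℕ i))) (Weight.subsum-⁅⁆ w i)))))))
    then λ _ done →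
    let tot = trans done (Weight.subsum-cong w (below-full (λ _ → true))) in
    run-write (tot , cong dbl tot)
    where
    open Loaded loaded
    disjoint : ∀ (i v : Fin n) → ⁅ i ⁆ v ≡ true → below (λ _ → true) (toℕ i) v ≡ false
    disjoint i v e with i Fin.≟ v
    ... | yes refl = below-self (λ _ → true) i

  emit-correct : ∀ {σ} {L : Labelling n} → σ nat 0 0 ≡ n → (∀ v → σ nat LAB (toℕ v) ≡ toℕ (L v)) →
                 Run n emit σ λ τ → ∀ v → τ nat OUT (toℕ v) ≡ rank (live L) (toℕ (L v))
  emit-correct {σ₀} {L} order labels =
    run-write {Q = λ τ → τ ≡ update nat H 0 0 σ₀} refl then λ { _ refl →
    run-for Ranked refl refl order id
      (sym (Count.subsum-∅ {n} (λ _ → 1) {below (live L) 0} (below-0 (live L))) , λ _ ())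
      (λ { {σ} i fr v≡ (h≡ , ranks) →
        let lab′ : σ nat LAB (σ nat V 0) ≡ toℕ (L i)
            lab′ = trans (cong (σ nat LAB) v≡) (trans (fr nat LAB refl _) (labels i))
        in run-write {Q = λ τ → τ ≡ update nat RANK (σ nat V 0) (σ nat H 0) σ} refl then λ { _ refl →
           run-if
             (λ l≐v → run-write (trans (cong (ℕ._+ 1) h≡) (trans (ℕ.+-comm _ 1) (sym (rank-step (live L) i
                (live⁺ {L = L} (Fin.toℕ-injective (trans (sym lab′) (trans (≐⁻ l≐v) v≡))))))) , recorded σ i v≡ h≡ ranks))
             (λ l≢v → run-skip (trans h≡ (sym (rank-skip (live L) i (dec-false (L i Fin.≟ i)
                λ Li≡i → l≢v (≐⁺ (trans lab′ (trans (cong toℕ Li≡i) (sym v≡))))))) , recorded σ i v≡ h≡ ranks)) } })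
    then λ fr (_ , ranks) →
    run-fill nat OUT (λ v → rank (live L) (toℕ (L v))) refl refl refl (trans (fr nat 0 refl 0) order)
      λ {σ} i fr′ x≡ → trans
        (cong (σ nat RANK) (trans (cong (σ nat LAB) x≡) (trans (fr′ nat LAB refl _) (trans (fr nat LAB refl _) (labels i)))))
        (trans (fr′ nat RANK refl _) (ranks (L i) (Fin.toℕ<n (L i)))) }
    where
    Ranked : ℕ → Store → Set
    Ranked i σ = σ nat H 0 ≡ rank (live L) i × (∀ r → toℕ r ℕ.< i → σ nat RANK (toℕ r) ≡ rank (live L) (toℕ r))
    recorded : ∀ σ (i : Fin n) → σ nat V 0 ≡ toℕ i → σ nat H 0 ≡ rank (live L) (toℕ i) →
               (∀ r → toℕ r ℕ.< toℕ i → σ nat RANK (toℕ r) ≡ rank (live L) (toℕ r)) →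
               ∀ r → toℕ r ℕ.< suc (toℕ i) →
               update nat RANK (σ nat V 0) (σ nat H 0) σ nat RANK (toℕ r) ≡ rank (live L) (toℕ r)
    recorded σ i v≡ h≡ ranks r r< = update-at nat RANK σ v≡ (λ { refl → h≡ })
      λ i≢r → ranks r (ℕ.≤∧≢⇒< (ℕ.s≤s⁻¹ r<) λ r≡i → i≢r (Fin.toℕ-injective (sym r≡i)))

-- Naturals, halves and maxima among the rationals

fromℕ-+ : ∀ m n → fromℕ (m ℕ.+ n) ≡ fromℕ m ℚ.+ fromℕ n
fromℕ-+ m n = ℚ.toℚᵘ-injective (ℚᵘ.≃-trans (ℚ.toℚᵘ-fromℚᵘ (ℚᵘ.mkℚᵘ (+ (m ℕ.+ n)) 0))
  (ℚᵘ.≃-sym (ℚᵘ.≃-trans (ℚ.toℚᵘ-homo-+ (fromℕ m) (fromℕ n))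
    (ℚᵘ.≃-trans (ℚᵘ.+-cong (ℚ.toℚᵘ-fromℚᵘ (ℚᵘ.mkℚᵘ (+ m) 0)) (ℚ.toℚᵘ-fromℚᵘ (ℚᵘ.mkℚᵘ (+ n) 0)))
      (ℚᵘ.*≡* (cong (ℤ._* + 1) (cong₂ ℤ._+_ (ℤ.*-identityʳ (+ m)) (ℤ.*-identityʳ (+ n)))))))))

fromℕ-* : ∀ m n → fromℕ (m ℕ.* n) ≡ fromℕ m ℚ.* fromℕ n
fromℕ-* m n = ℚ.toℚᵘ-injective (ℚᵘ.≃-trans (ℚ.toℚᵘ-fromℚᵘ (ℚᵘ.mkℚᵘ (+ (m ℕ.* n)) 0))
  (ℚᵘ.≃-sym (ℚᵘ.≃-trans (ℚ.toℚᵘ-homo-* (fromℕ m) (fromℕ n))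
    (ℚᵘ.≃-trans (ℚᵘ.*-cong (ℚ.toℚᵘ-fromℚᵘ (ℚᵘ.mkℚᵘ (+ m) 0)) (ℚ.toℚᵘ-fromℚᵘ (ℚᵘ.mkℚᵘ (+ n) 0)))
      (ℚᵘ.*≡* (cong (ℤ._* + 1) (sym (ℤ.pos-* m n))))))))

fromℕ-mono : ∀ {m n} → m ℕ.≤ n → fromℕ m ℚ.≤ fromℕ n
fromℕ-mono {m} {n} m≤n = ℚ.toℚᵘ-cancel-≤ (ℚᵘ.≤-respˡ-≃ (ℚᵘ.≃-sym (ℚ.toℚᵘ-fromℚᵘ (ℚᵘ.mkℚᵘ (+ m) 0)))
  (ℚᵘ.≤-respʳ-≃ (ℚᵘ.≃-sym (ℚ.toℚᵘ-fromℚᵘ (ℚᵘ.mkℚᵘ (+ n) 0)))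
    (ℚᵘ.*≤* (subst₂ ℤ._≤_ (sym (ℤ.*-identityʳ (+ m))) (sym (ℤ.*-identityʳ (+ n))) (ℤ.+≤+ m≤n)))))

dbl-half : ∀ k → dbl (+ k ℚ./ 2) ≡ fromℕ k
dbl-half k = ℚ.toℚᵘ-injective (ℚᵘ.≃-trans (ℚ.toℚᵘ-homo-+ (+ k ℚ./ 2) (+ k ℚ./ 2))
  (ℚᵘ.≃-trans (ℚᵘ.+-cong half half) (ℚᵘ.≃-trans (ℚᵘ.*≡* eq) (ℚᵘ.≃-sym (ℚ.toℚᵘ-fromℚᵘ (ℚᵘ.mkℚᵘ (+ k) 0))))))
  where
  half : ℚ.toℚᵘ (+ k ℚ./ 2) ℚᵘ.≃ ℚᵘ.mkℚᵘ (+ k) 1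
  half = ℚ.toℚᵘ-fromℚᵘ (ℚᵘ.mkℚᵘ (+ k) 1)
  eq : ((+ k) ℤ.* + 2 ℤ.+ (+ k) ℤ.* + 2) ℤ.* + 1 ≡ (+ k) ℤ.* + 4
  eq = trans (ℤ.*-identityʳ _) (sym (ℤ.*-distribˡ-+ (+ k) (+ 2) (+ 2)))

dbl-cancel : ∀ {x y} → dbl x ℚ.≤ dbl y → x ℚ.≤ y
dbl-cancel x≤y = ℚ.≮⇒≥ λ y<x → <⇒≱ (ℚ.+-mono-< y<x y<x) x≤y

half-bound : ∀ {k x m ε′} → 0ℚ ℚ.≤ m → 0ℚ ℚ.≤ ε′ → dbl x ℚ.≤ fromℕ k ℚ.* m → x ℚ.≤ (+ k ℚ./ 2 ℚ.+ ε′) ℚ.* m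
half-bound {k} {x} {m} {ε′} 0≤m 0≤ε′ dblx≤ = begin
  x                                 ≤⟨ dbl-cancel (ℚ.≤-trans dblx≤ (ℚ.≤-reflexive halves)) ⟩
  (+ k ℚ./ 2) ℚ.* m                 ≡⟨ cong (ℚ._* m) (ℚ.+-identityʳ (+ k ℚ./ 2)) ⟨
  (+ k ℚ./ 2 ℚ.+ 0ℚ) ℚ.* m          ≤⟨ ℚ.*-monoʳ-≤-nonNeg m {{ℚ.nonNegative 0≤m}} (ℚ.+-monoʳ-≤ (+ k ℚ./ 2) 0≤ε′) ⟩
  (+ k ℚ./ 2 ℚ.+ ε′) ℚ.* m          ∎
  where
  open ℚ.≤-Reasoning
  halves : fromℕ k ℚ.* m ≡ dbl ((+ k ℚ./ 2) ℚ.* m)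
  halves = trans (cong (ℚ._* m) (sym (dbl-half k))) (ℚ.*-distribʳ-+ m (+ k ℚ./ 2) (+ k ℚ./ 2))

module _ {k : ℕ} (f : Fin k → ℚ) where

  ⊔-upper : ∀ i → f i ℚ.≤ Vector.foldr ℚ._⊔_ 0ℚ f
  ⊔-upper = go f
    where
    go : ∀ {k} (f : Fin k → ℚ) i → f i ℚ.≤ Vector.foldr ℚ._⊔_ 0ℚ f
    go f zero    = ℚ.p≤p⊔q (f zero) _
    go f (suc i) = ℚ.≤-trans (go (f ∘ suc) i) (ℚ.p≤q⊔p (f zero) _)

  ⊔-nonneg : 0ℚ ℚ.≤ Vector.foldr ℚ._⊔_ 0ℚ f
  ⊔-nonneg = go f
    where
    go : ∀ {k} (f : Fin k → ℚ) → 0ℚ ℚ.≤ Vector.foldr ℚ._⊔_ 0ℚ f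
    go {zero}  f = ℚ.≤-refl
    go {suc k} f = ℚ.≤-trans (go (f ∘ suc)) (ℚ.p≤q⊔p (f zero) _)

  ⊔-least : ∀ {x} → 0ℚ ℚ.≤ x → (∀ i → f i ℚ.≤ x) → Vector.foldr ℚ._⊔_ 0ℚ f ℚ.≤ x
  ⊔-least = go f
    where
    go : ∀ {k} (f : Fin k → ℚ) {x} → 0ℚ ℚ.≤ x → (∀ i → f i ℚ.≤ x) → Vector.foldr ℚ._⊔_ 0ℚ f ℚ.≤ x
    go {zero}  f 0≤x f≤x = 0≤x
    go {suc k} f 0≤x f≤x = ℚ.⊔-lub (f≤x zero) (go (f ∘ suc) 0≤x (f≤x ∘ suc))

module _ {n k : ℕ} {G : Graph n} (P : ConnectedPartition k G) where

  ∈-part⁺ : ∀ {v i} → class P v ≡ i → v Subset.∈ part P i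
  ∈-part⁺ {v} {i} e = lookup⇒[]= v (part P i) (trans (lookup∘tabulate _ v) (dec-true (class P v Fin.≟ i) e))

  ∈-part⁻ : ∀ {v i} → v Subset.∈ part P i → class P v ≡ i
  ∈-part⁻ {v} {i} v∈ = does⁻ (class P v Fin.≟ i) (trans (sym (lookup∘tabulate _ v)) ([]=⇒lookup v∈))

  weight-part : ∀ (w : Fin n → ℚ) i → weight w (part P i) ≡ Weight.subsum w (⁅ i ⁆ ∘ class P)
  weight-part w i = Weight.subsum-cong w cell
    where
    cell : ∀ v → does (v Subset.∈? part P i) ≡ ⁅ i ⁆ (class P v)
    cell v with i Fin.≟ class P v
    ... | yes e = dec-true (v Subset.∈? part P i) (∈-part⁺ (sym e))
    ... | no ne = dec-false (v Subset.∈? part P i) (ne ∘ sym ∘ ∈-part⁻)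

-- The approximation ratio

module Approximation {n : ℕ} {{n≢0 : NonZero n}} (G : Graph n) {w : Fin n → ℚ} (w≥0 : ∀ v → 0ℚ ℚ.≤ w v)
                     {k : ℕ} (3≤k : 3 ℕ.≤ k) where
  open Graph G
  open Framing G w≥0 public

  module _ (Q : ConnectedPartition k G) where

    opt : ℚ
    opt = w⁺ w Q

    opt≥0 : 0ℚ ℚ.≤ opt
    opt≥0 = ⊔-nonneg (λ i → weight w (part Q i))

    within≤opt : ∀ {p : Pred n} j → (∀ v → p v ≡ true → class Q v ≡ j) → Weight.subsum w p ℚ.≤ opt
    within≤opt {p} j within = begin
      Weight.subsum w p
        ≤⟨ ⟨⟩-mono w≥0 {p} {⁅ j ⁆ ∘ class Q} (λ v e → dec-true (j Fin.≟ class Q v) (sym (within v e))) ⟩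
      Weight.subsum w (⁅ j ⁆ ∘ class Q)     ≡⟨ weight-part Q w j ⟨
      weight w (part Q j)                   ≤⟨ ⊔-upper (λ i → weight w (part Q i)) j ⟩
      opt                                   ∎
      where open ℚ.≤-Reasoning

    total≤ : total ℚ.≤ fromℕ k ℚ.* opt
    total≤ = subst (ℚ._≤ fromℕ k ℚ.* opt) (Weight.subsum-cong w λ v → below-full (λ _ → true) (class Q v)) (go k ℕ.≤-refl)
      where
      Below : ℕ → Pred n
      Below i v = below {k} (λ _ → true) i (class Q v)
      go : ∀ i → i ℕ.≤ k → Weight.subsum w (Below i) ℚ.≤ fromℕ i ℚ.* opt
      go zero _ = ℚ.≤-reflexive (trans (Weight.subsum-∅ w {Below 0} (λ _ → refl)) (sym (ℚ.*-zeroˡ opt)))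
      go (suc i) i<k = begin
        Weight.subsum w (Below (suc i))
          ≡⟨ Weight.subsum-⊎ w {⁅ j ⁆ ∘ class Q} {Below i} {Below (suc i)} cell disjoint ⟩
        Weight.subsum w (⁅ j ⁆ ∘ class Q) ℚ.+ Weight.subsum w (Below i)
          ≤⟨ ℚ.+-mono-≤ (within≤opt {⁅ j ⁆ ∘ class Q} j λ v e → sym (does⁻ (j Fin.≟ class Q v) e))
                        (go i (ℕ.<⇒≤ i<k)) ⟩
        opt ℚ.+ fromℕ i ℚ.* opt                  ≡⟨ cong (ℚ._+ fromℕ i ℚ.* opt) (ℚ.*-identityˡ opt) ⟨
        fromℕ 1 ℚ.* opt ℚ.+ fromℕ i ℚ.* opt      ≡⟨ ℚ.*-distribʳ-+ opt (fromℕ 1) (fromℕ i) ⟨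
        (fromℕ 1 ℚ.+ fromℕ i) ℚ.* opt            ≡⟨ cong (ℚ._* opt) (fromℕ-+ 1 i) ⟨
        fromℕ (suc i) ℚ.* opt                    ∎
        where
        open ℚ.≤-Reasoning
        j : Fin k
        j = fromℕ< i<k
        cell : ∀ v → Below (suc i) v ≡ ⁅ j ⁆ (class Q v) ∨ Below i v
        cell v = subst (λ i → Below (suc i) v ≡ ⁅ j ⁆ (class Q v) ∨ Below i v) (Fin.toℕ-fromℕ< i<k)
                   (below-suc (λ _ → true) j (class Q v) refl)
        disjoint : ∀ v → ⁅ j ⁆ (class Q v) ≡ true → Below i v ≡ false
        disjoint v e with does⁻ (j Fin.≟ class Q v) e
        ... | j≡ = trans (cong (λ u → below (λ _ → true) i u) (sym j≡))
                     (subst (λ i → below (λ _ → true) i j ≡ false) (Fin.toℕ-fromℕ< i<k) (below-self (λ _ → true) j))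

    -- Brings a bound by the optimum itself to the doubled form shared by all classes; it costs
    -- `2 ≤ k`.
    ≤opt⇒light : ∀ {x} → x ℚ.≤ opt → dbl x ℚ.≤ fromℕ k ℚ.* opt
    ≤opt⇒light {x} x≤ = begin
      x ℚ.+ x                               ≤⟨ ℚ.+-mono-≤ x≤ x≤ ⟩
      opt ℚ.+ opt                           ≡⟨ cong₂ ℚ._+_ (ℚ.*-identityˡ opt) (ℚ.*-identityˡ opt) ⟨
      fromℕ 1 ℚ.* opt ℚ.+ fromℕ 1 ℚ.* opt   ≡⟨ ℚ.*-distribʳ-+ opt (fromℕ 1) (fromℕ 1) ⟨
      fromℕ 2 ℚ.* opt
        ≤⟨ ℚ.*-monoʳ-≤-nonNeg opt {{ℚ.nonNegative opt≥0}} (fromℕ-mono (ℕ.≤-trans (ℕ.n≤1+n 2) 3≤k)) ⟩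
      fromℕ k ℚ.* opt                       ∎
      where open ℚ.≤-Reasoning

    -- Every class of Q avoiding the hub c lies in one class of L₀, so at most
    -- k - 1 classes of L₀ other than c's are not contained in the class of c in Q.
    module _ {c : Fin n} {L₀ : Labelling n} (closed : ∀ {u v} → u ≢ c → v ≢ c → u ~ v → L₀ u ≡ L₀ v) where
      open Condensing {k} {c} {L₀}

      private
        representative : Fin k → Fin n
        representative j = proj₁ (ConnectedPartition.nonempty Q j)

        touched : Fin k → Fin n
        -- The index of the competitor's class around the hub is spent on the label `c`: thus `S`
        -- contains `c` and still has at most `k` elements.
        touched j = if does (j Fin.≟ class Q c) then c else L₀ (representative j)

        S : Pred n
        S = image touched

        S-hub : S c ≡ true
        S-hub = subst (λ v → S v ≡ true) hub (image-∋ touched (class Q c))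
          where
          hub : touched (class Q c) ≡ c
          hub rewrite dec-true (class Q c Fin.≟ class Q c) refl = refl

        same-class : ∀ {j u v} → j ≢ class Q c → Star (InducedEdge (part Q j)) u v → L₀ u ≡ L₀ v
        same-class j≢ ε = refl
        same-class {j} j≢ ((u∈ , v∈ , u~v) ◅ path) = trans
          (closed (λ { refl → j≢ (sym (∈-part⁻ Q u∈)) }) (λ { refl → j≢ (sym (∈-part⁻ Q v∈)) }) u~v)
          (same-class j≢ path)

        touched-∋ : ∀ v → class Q v ≢ class Q c → S (L₀ v) ≡ true
        touched-∋ v j≢ = subst (λ u → S u ≡ true) eq (image-∋ touched (class Q v))
          where
          eq : touched (class Q v) ≡ L₀ v
          eq rewrite dec-false (class Q v Fin.≟ class Q c) j≢ =
            same-class j≢ (ConnectedPartition.connected Q (class Q v)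
              (proj₂ (ConnectedPartition.nonempty Q (class Q v))) (∈-part⁺ Q refl))

        untouched : ∀ v → not (Touching S v) ≡ true → class Q v ≡ class Q c
        untouched v e with class Q v Fin.≟ class Q c
        ... | yes same = same
        ... | no  diff rewrite touched-∋ v diff with c Fin.≟ v
        ...   | yes refl = refl
        ...   | no  _    = contradiction e λ ()

      -- Complements are compared: what lies outside the hub's class in `L` outweighs `Touching S`
      -- by `greedy`, and all vertices not in `Touching S` belong to the class of `c` in `Q`.
      hub≤opt : ∀ {L} → count L ≡ k → Condensed L → clsWeight w L c ℚ.≤ opt
      hub≤opt {L} count≡k cond = ℚ.≮⇒≥ λ opt<hub → ℚ.<-irrefl refl (begin-strict
        total
          ≡⟨ complement (Touching S) (not ∘ Touching S) (λ _ → refl) ⟨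
        Weight.subsum w (Touching S) ℚ.+ Weight.subsum w (not ∘ Touching S)
          ≤⟨ ℚ.+-mono-≤ touching≤ (within≤opt {not ∘ Touching S} (class Q c) untouched) ⟩
        Weight.subsum w (Outside L) ℚ.+ opt
          <⟨ ℚ.+-monoʳ-< (Weight.subsum w (Outside L)) opt<hub ⟩
        Weight.subsum w (Outside L) ℚ.+ clsWeight w L c
          ≡⟨ ℚ.+-comm _ (clsWeight w L c) ⟩
        clsWeight w L c ℚ.+ Weight.subsum w (Outside L)
          ≡⟨ complement (cls L c) (Outside L) (λ _ → refl) ⟩
        total ∎)
        where
        open ℚ.≤-Reasoning
        touching≤ : Weight.subsum w (Touching S) ℚ.≤ Weight.subsum w (Outside L)
        touching≤ = Condensed.greedy cond S S-hub (subst (# S ℕ.≤_) (sym count≡k) (#-image touched))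

  module _ {c : Fin n} {L₀ L : Labelling n} (alone : HubAlone c L₀) (stuck : Stuck k c L₀)
           (count≡k : count L ≡ k) where
    open Condensing {k} {c} {L₀}

    module _ (cond : Condensed L) where
      open Condensed cond

      -- `greedy` applies to the set of the labels `c`, `L₀ u` and `L₀ v` because `3 ≤ k`. The two
      -- classes would then together weigh no more than the complement of a heavy class, and `Stuck`
      -- says that such a pair cannot remain.
      heavy-hub-closed : k ℕ.< count L₀ → total ℚ.< dbl (clsWeight w L c) →
                         ∀ {u v} → u ≢ c → v ≢ c → u ~ v → L₀ u ≡ L₀ v
      heavy-hub-closed k<₀ heavy {u} {v} u≢c v≢c u~v with L₀ u Fin.≟ L₀ v | stuck u≢c v≢c u~v
      ... | yes e | _ = e
      ... | no _ | inj₁ e = e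
      ... | no _ | inj₂ (inj₁ ≤k) = contradiction k<₀ (ℕ.≤⇒≯ ≤k)
      ... | no l≢ | inj₂ (inj₂ t<pair) = contradiction pair≤ (<⇒≱ t<pair)
        where
        S : Pred n
        S x = ⁅ c ⁆ x ∨ (⁅ L₀ u ⁆ x ∨ ⁅ L₀ v ⁆ x)
        S-hub : S c ≡ true
        S-hub rewrite dec-true (c Fin.≟ c) refl = refl
        #S : # S ℕ.≤ 3
        #S = ℕ.≤-trans (#-insert-≤ {p = λ x → ⁅ L₀ u ⁆ x ∨ ⁅ L₀ v ⁆ x} {S} c λ _ → refl)
          (s≤s (ℕ.≤-trans (#-insert-≤ {p = ⁅ L₀ v ⁆} {λ x → ⁅ L₀ u ⁆ x ∨ ⁅ L₀ v ⁆ x} (L₀ u) λ _ → refl)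
            (s≤s (ℕ.≤-reflexive (Count.subsum-⁅⁆ (λ _ → 1) (L₀ v))))))
        Pair : Pred n
        Pair x = cls L₀ (L₀ u) x ∨ cls L₀ (L₀ v) x
        disjoint : ∀ x → cls L₀ (L₀ u) x ≡ true → cls L₀ (L₀ v) x ≡ false
        disjoint x e = dec-false (L₀ x Fin.≟ L₀ v) λ f → l≢ (trans (sym (does⁻ (L₀ x Fin.≟ L₀ u) e)) f)
        rim : ∀ {x y} → y ≢ c → L₀ x ≡ L₀ y → not (⁅ c ⁆ x) ≡ true
        rim {x} y≢c e = cong not (dec-false (c Fin.≟ x) λ { refl → y≢c (alone _ (sym e)) })
        incl : ∀ x → Pair x ≡ true → Touching S x ≡ true
        incl x e with L₀ x Fin.≟ L₀ u | L₀ x Fin.≟ L₀ v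
        ... | yes eu | _ rewrite dec-true (L₀ u Fin.≟ L₀ x) (sym eu) | Bool.∨-zeroʳ (⁅ c ⁆ (L₀ x)) = rim u≢c eu
        ... | no _ | yes ev rewrite dec-true (L₀ v Fin.≟ L₀ x) (sym ev) | Bool.∨-zeroʳ (⁅ L₀ u ⁆ (L₀ x))
                                 | Bool.∨-zeroʳ (⁅ c ⁆ (L₀ x)) = rim v≢c ev
        ... | no _ | no _ = contradiction e λ ()
        pair≤ : pairWeight L₀ u v ℚ.≤ total
        pair≤ = begin
          pairWeight L₀ u v
            ≡⟨ cong dbl (Weight.subsum-⊎ w {cls L₀ (L₀ u)} {cls L₀ (L₀ v)} {Pair} (λ _ → refl) disjoint) ⟨
          dbl (Weight.subsum w Pair)
            ≤⟨ dbl-mono (⟨⟩-mono w≥0 {Pair} {Touching S} incl) ⟩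
          dbl (Weight.subsum w (Touching S))
            ≤⟨ dbl-mono (greedy S S-hub (subst (# S ℕ.≤_) (sym count≡k) (ℕ.≤-trans #S 3≤k))) ⟩
          dbl (Weight.subsum w (Outside L))
            ≤⟨ other-part-light {clsWeight w L c} {Weight.subsum w (Outside L)}
                 (complement (cls L c) (Outside L) λ _ → refl) heavy ⟩
          total ∎
          where open ℚ.≤-Reasoning

      hub-light : ∀ Q → dbl (clsWeight w L c) ℚ.≤ fromℕ k ℚ.* opt Q
      hub-light Q with progress
      -- Without absorptions the hub's class is the single vertex `c`, which lies inside one class
      -- of `Q`.
      ... | inj₁ same = ≤opt⇒light Q (within≤opt Q {cls L c} (class Q c) λ v e →
              cong (class Q) (alone v (trans (sym (same v)) (trans (does⁻ (L v Fin.≟ c) e) (trans (sym hub-self) (same c))))))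
      ... | inj₂ k<₀ with dbl (clsWeight w L c) ℚ.≤? total
      ...   | yes light = ℚ.≤-trans light (total≤ Q)
      ...   | no  heavy = ≤opt⇒light Q (hub≤opt Q (heavy-hub-closed k<₀ (ℚ.≰⇒> heavy)) {L} count≡k cond)

      class-light : ∀ Q x → dbl (clsWeight w L (L x)) ℚ.≤ fromℕ k ℚ.* opt Q
      class-light Q x with L x Fin.≟ c
      ... | yes Lx≡c = subst (λ l → dbl (clsWeight w L l) ℚ.≤ fromℕ k ℚ.* opt Q) (sym Lx≡c) (hub-light Q)
      ... | no Lx≢c  = ℚ.≤-trans (light x Lx≢c) (total≤ Q)

  module Ranked {L : Labelling n} (idem : Idempotent L) (connects : Connects _~_ L) (count≡k : count L ≡ k) where

    rank<k : ∀ v → rank (live L) (toℕ (L v)) ℕ.< k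
    rank<k v = subst (_ ℕ.<_) count≡k (rank-<# (live L) (live⁺ {L = L} (idem v)))

    classOf : Fin n → Fin k
    classOf v = fromℕ< (rank<k v)

    classOf-injective : ∀ {u v} → classOf u ≡ classOf v → L u ≡ L v
    classOf-injective {u} {v} e = rank-injective (live L) (live⁺ {L = L} (idem u)) (live⁺ {L = L} (idem v))
      (trans (sym (Fin.toℕ-fromℕ< (rank<k u))) (trans (cong toℕ e) (Fin.toℕ-fromℕ< (rank<k v))))

    classOf-surjective : ∀ i → ∃[ r ] (L r ≡ r × classOf r ≡ i)
    classOf-surjective i =
      let r , live-r , rank≡ = rank-surjective (live L) (subst (toℕ i ℕ.<_) (sym count≡k) (Fin.toℕ<n i))
          Lr≡r = live⁻ {L = L} live-r
      in r , Lr≡r , Fin.toℕ-injective (trans (Fin.toℕ-fromℕ< (rank<k r)) (trans (cong (rank (live L) ∘ toℕ) Lr≡r) rank≡))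

    in-part : ∀ {v i} → classOf v ≡ i → v Subset.∈ tabulate (λ v → does (classOf v Fin.≟ i))
    in-part {v} {i} e = lookup⇒[]= v _ (trans (lookup∘tabulate _ v) (dec-true (classOf v Fin.≟ i) e))

    out-part : ∀ {v i} → v Subset.∈ tabulate (λ v → does (classOf v Fin.≟ i)) → classOf v ≡ i
    out-part {v} {i} v∈ = does⁻ (classOf v Fin.≟ i) (trans (sym (lookup∘tabulate _ v)) ([]=⇒lookup v∈))

    partition : ConnectedPartition k G
    partition = record
      { class = classOf
      ; nonempty = λ i → let r , _ , e = classOf-surjective i in r , in-part e
      ; connected = λ i u∈ v∈ →
          induced (out-part u∈) (connects (classOf-injective (trans (out-part u∈) (sym (out-part v∈))))) }
      where
      label-class : ∀ {u v} → L u ≡ L v → classOf u ≡ classOf v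
      label-class {u} {v} e = Fin.toℕ-injective (trans (Fin.toℕ-fromℕ< (rank<k u))
        (trans (cong (rank (live L) ∘ toℕ) e) (sym (Fin.toℕ-fromℕ< (rank<k v)))))
      induced : ∀ {i u v} → classOf u ≡ i → LabelPath _~_ L u v →
                Star (InducedEdge (tabulate λ v → does (classOf v Fin.≟ i))) u v
      induced e ε = ε
      induced {i} {u} e ((u~x , Lu≡Lx) ◅ path) =
        let e′ = trans (sym (label-class Lu≡Lx)) e in (in-part e , in-part e′ , u~x) ◅ induced e′ path

    w⁺-light : ∀ {y} → 0ℚ ℚ.≤ y → (∀ x → clsWeight w L (L x) ℚ.≤ y) → w⁺ w partition ℚ.≤ y
    w⁺-light {y} 0≤y light = ⊔-least (λ i → weight w (part partition i)) 0≤y bound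
      where
      bound : ∀ i → weight w (part partition i) ℚ.≤ y
      bound i with classOf-surjective i
      ... | r , Lr≡r , e = ℚ.≤-trans (ℚ.≤-reflexive (weight-part partition w i))
        (ℚ.≤-trans (⟨⟩-mono w≥0 {⁅ i ⁆ ∘ classOf} {cls L (L r)} λ v f →
          dec-true (L v Fin.≟ L r) (classOf-injective (trans (sym (does⁻ (i Fin.≟ classOf v) f)) (sym e)))) (light r))

-- The algorithm

approximate : ℕ → Program
approximate k = tally ⨾ descend ⨾ balance k ⨾ condense ⨾ emit

module Solving {k : ℕ} (3≤k : 3 ℕ.≤ k) (I : Instance k) where
  open Instance I renaming (∣V∣ to n; graph to G)
  open Graph G using (_~_; _~?_; ~-sym; ~-irrefl; edges; InducedEdge)

  3≤n : 3 ℕ.≤ n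
  3≤n = ℕ.≤-trans 3≤k k≤∣V∣

  instance
    n≢0 : NonZero n
    n≢0 = ℕ.>-nonZero (ℕ.<-trans ℕ.z<s (ℕ.≤-trans (ℕ.n≤1+n 2) 3≤n))

  open Approximation G w-nonneg 3≤k

  adjacency-at : ∀ u v → adjacency I (toℕ u ℕ.* n ℕ.+ toℕ v) ≡ (if does (u ~? v) then 1 else 0)
  adjacency-at u v with toℕ u ℕ.* n ℕ.+ toℕ v | position
    where
    position : toℕ u ℕ.* n ℕ.+ toℕ v ≡ toℕ (Fin.combine u v)
    position = trans (cong (ℕ._+ toℕ v) (ℕ.*-comm (toℕ u) n)) (sym (Fin.toℕ-combine u v))
  ... | _ | refl with toℕ (Fin.combine u v) ℕ.<? n ℕ.* n
  ...   | no  ≥n² = contradiction (Fin.toℕ<n (Fin.combine u v)) ≥n²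
  ...   | yes <n² = cong (uncurry λ u v → if does (u ~? v) then 1 else 0)
    (trans (cong (Fin.remQuot n) (Fin.fromℕ<-toℕ (Fin.combine u v) <n²)) (Fin.remQuot-combine {n} {n} u v))

  weights-at : ∀ v → weights I (toℕ v) ≡ w v
  weights-at v with toℕ v ℕ.<? n
  ... | yes <n = cong w (Fin.fromℕ<-toℕ v <n)
  ... | no  ≥n = contradiction (Fin.toℕ<n v) ≥n

  loaded : Loaded G w (load I)
  loaded = record { order = refl ; edge = adjacency-at ; masses = weights-at }

  start : Fin n
  start = fromℕ< (ℕ.>-nonZero⁻¹ n)

  -- Zeroed memory already describes a valid search: vertex 0 is the hub, all vertices are on its
  -- side, and `Attached` is the connectedness of the graph.
  descending : ∀ {σ} → σ nat C 0 ≡ 0 → (∀ v → σ nat SIDE v ≡ 0) → σ nat FLAG 0 ≡ 0 → Descending n σ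
  descending hub sides flag = start , (λ _ → 0) , trans hub (sym (Fin.toℕ-fromℕ< (ℕ.>-nonZero⁻¹ n))) , (λ v → sides _) ,
    inj₁ (flag , (λ x → Star.map (λ (_ , _ , u~v) → u~v , inj₁ refl) (G-connected Subset.∈⊤ Subset.∈⊤)) ,
      ℚ.≤-trans (dbl-mono (ℚ.≤-reflexive (Weight.subsum-∅ w {OffHub (λ _ → 0) start} λ _ → refl)))
                (⟨⟩-nonneg w-nonneg (λ _ → true)) ,
      ℕ.≤-trans (#-mono {p = InHub (λ _ → 0) start} {λ _ → true} λ _ _ → refl) (ℕ.≤-reflexive (#-full n)))

  Solved : Store → Set
  Solved τ = ∃[ P ] (Represents I τ P ×
    ∀ (Q : ConnectedPartition k G) {ε′} → 0ℚ ℚ.≤ ε′ → w⁺ w P ℚ.≤ (+ k ℚ./ 2 ℚ.+ ε′) ℚ.* w⁺ w Q)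

  solve : Run n (approximate k) (load I) Solved
  solve =
    tally-correct loaded refl then λ {τ₁} fr₁ (tot , lim) →
    descend-correct (loaded-frame {tally} refl refl refl fr₁ loaded) tot lim (fr₁ nat K refl 0)
      (descending {τ₁} (fr₁ nat C refl 0) (fr₁ nat SIDE refl) (fr₁ nat FLAG refl 0)) then λ fr₂ centred →
    balance-correct
      (loaded-frame {descend} refl refl refl fr₂ (loaded-frame {tally} refl refl refl fr₁ loaded))
      (trans (fr₂ rat TOTAL refl 0) tot) (trans (fr₂ rat T refl 0) lim) k≤∣V∣ centred
    then λ fr₃ (c , L₀ , hub , quota , st , idem , k≤ , wheel , stuck) →
    let order₃ = trans (fr₃ nat 0 refl 0) (trans (fr₂ nat 0 refl 0) (fr₁ nat 0 refl 0)) in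
    Condensing.condense-correct {k} {c} {L₀} order₃ hub quota (ℕ.≤-trans ℕ.z<s 3≤k)
      ( L₀ , st , idem , k≤
      , ℕ.≤-trans (#-mono {p = live L₀} {λ _ → true} λ _ _ → refl) (ℕ.≤-reflexive (#-full n))
      , Condensing.condensed-start idem wheel )
    then λ fr₄ (L , (labels , _) , idem′ , count≡k , cond) →
    run-conseq (emit-correct {L = L} (trans (fr₄ nat 0 refl 0) order₃) labels) λ _ out →
      let open Ranked {L} idem′ (Condensing.Condensed.connects cond) count≡k in
      partition , (λ v → trans (out v) (sym (Fin.toℕ-fromℕ< (rank<k v)))) ,
      λ Q {ε′} 0≤ε′ →
        let light = class-light (Wheel.alone wheel) stuck count≡k cond Q
            bound = λ x → half-bound {k} {ε′ = ε′} (opt≥0 Q) 0≤ε′ (light x)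
        in w⁺-light (ℚ.≤-trans (⟨⟩-nonneg w-nonneg (cls L (L start))) (bound start)) bound

  has-neighbour : ∀ v → ∃[ u ] v ~ u
  has-neighbour v with pigeonhole {p = ⁅ v ⁆} {λ _ → true}
    (subst₂ ℕ._<_ (sym (Count.subsum-⁅⁆ (λ _ → 1) v)) (sym (#-full n)) (ℕ.≤-trans (ℕ.n≤1+n 2) 3≤n))
  ... | u , _ , v≢u with G-connected {v} {u} Subset.∈⊤ Subset.∈⊤
  ...   | ε = contradiction refl (does⁻¬ (v Fin.≟ v) v≢u)
  ...   | (_ , _ , v~x) ◅ _ = _ , v~x

  endpoints : List (Fin n)
  endpoints = map proj₁ edges ++ map proj₂ edges

  edges-∋ : ∀ {u v} → toℕ u ℕ.< toℕ v → u ~ v → (u , v) List.∈ edges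
  edges-∋ {u} {v} u<v u~v = ∈-filter⁺ (uncurry λ u v → (u Fin.<? v) ×-dec (u ~? v))
    (∈-cartesianProduct⁺ (∈-allFin u) (∈-allFin v)) (u<v , u~v)

  endpoints-∋ : ∀ v → v List.∈ endpoints
  endpoints-∋ v with has-neighbour v
  ... | u , v~u with ℕ.<-cmp (toℕ v) (toℕ u)
  ...   | tri< v<u _ _ = ∈-++⁺ˡ (∈-map⁺ proj₁ (edges-∋ v<u v~u))
  ...   | tri≈ _ v≡u _ = contradiction v~u (~-irrefl (Fin.toℕ-injective v≡u))
  ...   | tri> _ _ u<v = ∈-++⁺ʳ (map proj₁ edges) (∈-map⁺ proj₂ (edges-∋ u<v (~-sym v~u)))

  -- No vertex is isolated, so each occurs in the list of the 2m ends of edges; choosing one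
  -- occurrence per vertex is injective.
  n≤2m : n ℕ.≤ 2 ℕ.* ∣E∣
  n≤2m = subst (n ℕ.≤_)
    (trans (length-++ (map proj₁ edges)) (cong₂ ℕ._+_ (length-map proj₁ edges)
      (trans (length-map proj₂ edges) (sym (ℕ.+-identityʳ ∣E∣)))))
    (Fin.injective⇒≤ {f = λ v → index (endpoints-∋ v)} λ {u} {v} e →
      trans (lookup-index (endpoints-∋ u)) (trans (cong (lookup endpoints) e) (sym (lookup-index (endpoints-∋ v)))))

-- The time bound as a rational inequality

-- Division by a large `ε′` would shrink the bound; writing `z` as `z ε′ / ε′` shows that the factor
-- `D` makes up for it.
÷-bound : ∀ {t z D} ε′ {{_ : Positive ε′}} → t ℕ.≤ z → ε′ ℚ.≤ fromℕ D →
          fromℕ t ℚ.≤ ℚ._÷_ (fromℕ (z ℕ.* D)) ε′ {{ℚ.pos⇒nonZero ε′}}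
÷-bound {t} {z} {D} ε′ t≤z ε′≤D = begin
  fromℕ t                              ≤⟨ fromℕ-mono t≤z ⟩
  fromℕ z                              ≡⟨ ℚ.*-identityʳ (fromℕ z) ⟨
  fromℕ z ℚ.* ℚ.1ℚ                     ≡⟨ cong (fromℕ z ℚ.*_) (ℚ.*-inverseʳ ε′) ⟨
  fromℕ z ℚ.* (ε′ ℚ.* ℚ.1/ ε′)         ≡⟨ ℚ.*-assoc (fromℕ z) ε′ (ℚ.1/ ε′) ⟨
  fromℕ z ℚ.* ε′ ℚ.* ℚ.1/ ε′           ≤⟨ ℚ.*-monoʳ-≤-nonNeg (ℚ.1/ ε′) {{ℚ.pos⇒nonNeg (ℚ.1/ ε′) {{ℚ.1/pos⇒pos ε′}}}}
                                            (ℚ.*-monoˡ-≤-nonNeg (fromℕ z) {{ℚ.nonNegative (fromℕ-mono {0} {z} z≤n)}} ε′≤D) ⟩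
  fromℕ z ℚ.* fromℕ D ℚ.* ℚ.1/ ε′      ≡⟨ cong (ℚ._* ℚ.1/ ε′) (fromℕ-* z D) ⟨
  fromℕ (z ℕ.* D) ℚ.* ℚ.1/ ε′          ∎
  where
  open ℚ.≤-Reasoning
  instance
    ε′≢0 : ℚ.NonZero ε′
    ε′≢0 = ℚ.pos⇒nonZero ε′

-- Dropping a denominator, which is at least 1, gives an integer upper bound without rounding; the
-- absolute value covers negative `q`.
≤-numerator : ∀ q → q ℚ.≤ fromℕ ℤ.∣ ℚ.numerator q ∣
≤-numerator q@record{} = ℚ.toℚᵘ-cancel-≤ (ℚᵘ.≤-respʳ-≃ (ℚᵘ.≃-sym (ℚ.toℚᵘ-fromℚᵘ (ℚᵘ.mkℚᵘ (+ ℤ.∣ ℚ.numerator q ∣) 0)))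
  (ℚᵘ.*≤* (numerator≤ (ℚ.numerator q) (ℚ.denominator-1 q))))
  where
  numerator≤ : ∀ i d → i ℤ.* + 1 ℤ.≤ (+ ℤ.∣ i ∣) ℤ.* (+ suc d)
  numerator≤ (+ m) d = subst₂ ℤ._≤_ (ℤ.pos-* m 1) (ℤ.pos-* m (suc d)) (ℤ.+≤+ (ℕ.*-monoʳ-≤ m (s≤s z≤n)))
  numerator≤ ℤ.-[1+ m ] d = ℤ.-≤+

rate : ∀ {s D n m t} ε′ {{_ : Positive ε′}} → ε′ ℚ.≤ fromℕ D → n ℕ.≤ 2 ℕ.* m → t ℕ.≤ s ℕ.* n ℕ.^ 4 →
       fromℕ t ℚ.≤ ℚ._÷_ (fromℕ (s ℕ.* 2 ℕ.* D ℕ.* (n ℕ.^ 3 ℕ.* m))) ε′ {{ℚ.pos⇒nonZero ε′}}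
rate {s} {D} {n} {m} {t} ε′ ε′≤D n≤2m t≤ = subst (λ z → fromℕ t ℚ.≤ ℚ._÷_ (fromℕ z) ε′ {{ℚ.pos⇒nonZero ε′}})
  (rearrange s D (n ℕ.^ 3) m)
  (÷-bound {z = s ℕ.* (n ℕ.^ 3 ℕ.* (2 ℕ.* m))} {D} ε′ (ℕ.≤-trans t≤ (ℕ.*-monoʳ-≤ s
    (ℕ.≤-trans (ℕ.≤-reflexive (ℕ.*-comm n (n ℕ.^ 3))) (ℕ.*-monoʳ-≤ (n ℕ.^ 3) n≤2m)))) ε′≤D)
  where
  rearrange : ∀ s D c m → s ℕ.* (c ℕ.* (2 ℕ.* m)) ℕ.* D ≡ s ℕ.* 2 ℕ.* D ℕ.* (c ℕ.* m)
  rearrange = solve 4 (λ s D c m → s :* (c :* (con 2 :* m)) :* D := s :* con 2 :* D :* (c :* m)) refl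
    where open Data.Nat.Solver.+-*-Solver

-- The variable s stands for the numeral size A, which conversion would unfold in unary.
module _ {k : ℕ} (3≤k : 3 ℕ.≤ k) (A : Program) (s : ℕ) where

  Solves : Instance k → Set
  Solves I = ∃[ τ ] ∃[ t ] (⟨ A , load I ⟩⇓⟨ τ , t ⟩ × t ℕ.≤ s ℕ.* Instance.∣V∣ I ℕ.^ 4 × Solving.Solved 3≤k I τ)

  quartic⇒approximation : (∀ I → Solves I) → (ε̄ ε′ : ℚ) {{ε′>0 : Positive ε′}} → ε′ ℚ.≤ ε̄ →
    IsApproximationAlgorithm k ((+ k) ℚ./ 2 ℚ.+ ε′) A ×
    ((I : Instance k) → let open Instance I in
     ∃[ t ] (HaltsAfter I A t ×
       fromℕ t ℚ.≤ ℚ._÷_ (fromℕ (s ℕ.* 2 ℕ.* ℤ.∣ ℚ.numerator ε̄ ∣ ℕ.* (∣V∣ ℕ.^ 3 ℕ.* ∣E∣))) ε′ {{ℚ.pos⇒nonZero ε′}}))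
  quartic⇒approximation solves ε̄ ε′ ε′≤ε̄ =
    record
      { polynomialTime = s , 4 , λ I → let τ , t , halts , t≤ , _ = solves I in t , (τ , halts) ,
          ℕ.≤-trans t≤ (ℕ.*-monoʳ-≤ s (ℕ.^-monoˡ-≤ 4 (ℕ.m≤m+n (Instance.∣V∣ I) (Instance.∣E∣ I))))
      ; approximates = λ I → let τ , t , halts , _ , P , represents , approx = solves I in
          P , (τ , t , halts , represents) , λ Q _ → approx Q (ℚ.<⇒≤ (ℚ.positive⁻¹ ε′)) } ,
    λ I → let τ , t , halts , t≤ , _ = solves I in
      t , (τ , halts) , rate {s} {ℤ.∣ ℚ.numerator ε̄ ∣} {Instance.∣V∣ I} {Instance.∣E∣ I} ε′
        (ℚ.≤-trans ε′≤ε̄ (≤-numerator ε̄)) (Solving.n≤2m 3≤k I) t≤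

-- Evaluates only the nesting depth, so that the exponent becomes a numeral while `size p` stays
-- folded.
reindex : ∀ {p n t d} → depth p ≡ d → t ℕ.≤ size p ℕ.* n ℕ.^ depth p → t ℕ.≤ size p ℕ.* n ℕ.^ d
reindex refl t≤ = t≤

corollary8 : (k : ℕ) → 3 ℕ.≤ k → (ε̄ : ℚ) →
    ∃[ C ] ((ε′ : ℚ) {{ε′>0 : Positive ε′}} → ε′ ≤ ε̄ →
    ∃[ A ] (IsApproximationAlgorithm k ((+ k) / 2 + ε′) A ×
    ((I : Instance k) → let open Instance I in
    ∃[ t ] (HaltsAfter I A t ×
    fromℕ t ≤ _÷_ (fromℕ (C ℕ.* (∣V∣ ℕ.^ 3 ℕ.* ∣E∣))) ε′ {{pos⇒nonZero ε′}}))))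
corollary8 k 3≤k ε̄ = s ℕ.* 2 ℕ.* ℤ.∣ ℚ.numerator ε̄ ∣ , λ ε′ ε′≤ε̄ →
  approximate k , quartic⇒approximation 3≤k (approximate k) s solves ε̄ ε′ ε′≤ε̄
  where
  s : ℕ
  s = size (approximate k)

  solves : ∀ I → Solves 3≤k (approximate k) s I
  solves I = let ran halts t≤ solved = Solving.solve 3≤k I in
    _ , _ , halts , reindex {approximate k} {Instance.∣V∣ I} refl t≤ , solved
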